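{- Let $G_{\mathrm{AndI}}=(\{x,y\},\{x_j\mapsto q^jx_jy_{j+1},\ y_j\mapsto q^jx_j\},\mathrm{AIO})$, let $D$ be its $q$-derivative and $\phi$ the evaluation $\phi(x_j)=x$, $\phi(y_j)=y$. Then for every $n\ge0$, $$\phi\big(D^n(x_0)\big)=E^{I}_{n+1}(q;x,y).$$
   Context: $\mathbb{K}$ is a commutative ring with unity of characteristic zero, $q$ an indeterminate. Variables $x_i,y_i$ ($i\ge0$) form $\mathbb{S}$; $\mathbb{E}=\mathbb{K}[q][F(\mathbb{S})]$ is the group algebra of the free group on $\mathbb{S}$. The rule is extended to inverses by $R(s_i^{ -1})=-s_i^{ -1}R(s_i)s_{i+1}^{ -1}$; $\uparrow$ replaces every letter $s_i^{\pm1}$ by $s_{i+1}^{\pm1}$; AIO stably sorts the letters of a word by $x_0<y_0<x_1<y_1<\cdots$. The $q$-derivative is the $\mathbb{K}[q]$-linear map $D(w_1\cdots w_n)=\sum_{j=1}^n\mathrm{AIO}\big(w_1\cdots w_{j-1}R(w_j)\uparrow(w_{j+1}\cdots w_n)\big)$; $D^0=\mathrm{id}$. $\phi$ extends to a $\mathbb{K}[q]$-algebra homomorphism. An increasing binary tree on $[n]$ is a rooted tree with vertex set $[n]$, root $1$, labels increasing along every path from the root, in which every vertex has at most one left child and at most one right child. It is an André I tree if for every vertex with at least one child, the maximum label of its left subtree is smaller than the maximum label of its right subtree (maximum of the empty tree $:=0$). For such $T$: $l(T)$ is the number of leaves, $u(T)$ the number of vertices with exactly one child, and $\mathrm{inv}(T)$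 the number of pairs $(i,j)$ with $i>j$ such that either (1) $j$ is not on the path from $1$ to $i$ and some vertex $v$ on that path has $i$ in its left subtree and $j$ in its right subtree, or (2) $j$ lies on the path from $1$ to $i$ and the left child of $j$ lies on this path. $E^{I}_n(q;x,y)=\sum_{T}x^{l(T)}y^{u(T)}q^{\mathrm{inv}(T)}$, summed over André I trees on $[n]$. -}

module Defs where

open import Level using (Level)
open import Data.Bool using (Bool; true; false; _∧_; _∨_; not; if_then_else_)
open import Data.Nat using (ℕ; zero; suc; _+_; _*_; _≡ᵇ_; _<ᵇ_; _≤ᵇ_; _⊔_)
open import Data.Integer using (ℤ; +_; _-_)
import Data.Integer as ℤ
open import Data.List using (List; []; _∷_; _++_; map; concatMap; foldr; length; upTo)
open import Data.Bool.ListAction using (any; all)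
open import Data.Product using (Σ; _×_; _,_)
open import Data.Maybe using (Maybe; just; nothing)
open import Relation.Nullary using (does)
open import Relation.Binary.PropositionalEquality using (_≡_)
open import Algebra.Bundles using (CommutativeRing)

data Kind : Set where
  xK yK : Kind

record Letter : Set where
  constructor mkL
  field
    kind   : Kind
    index  : ℕ
    isInv  : Bool

Word : Set
Word = List Letter

-- AIO order  x0 < y0 < x1 < y1 < …  (signs of letters are ignored)
key : Letter → ℕ
key (mkL xK i _) = 2 * i
key (mkL yK i _) = suc (2 * i)

insertAIO : Letter → Word → Word
insertAIO a [] = a ∷ []
insertAIO a (b ∷ bs) = if key a ≤ᵇ key b then a ∷ b ∷ bs else b ∷ insertAIO a bs

AIO : Word → Word
AIO [] = []
AIO (a ∷ w) = insertAIO a (AIO w)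

shift : Word → Word
shift = map (λ { (mkL k i s) → mkL k (suc i) s })

-- The grammar G_AndI :  x_j ↦ q^j x_j y_{j+1},  y_j ↦ q^j x_j
-- A "signed monomial" (neg , e , w) stands for (-1)^neg q^e w.

SMon : Set
SMon = Bool × ℕ × Word

Rpos : Kind → ℕ → ℕ × Word
Rpos xK j = j , (mkL xK j false ∷ mkL yK (suc j) false ∷ [])
Rpos yK j = j , (mkL xK j false ∷ [])

R : Letter → SMon
R (mkL k j false) with Rpos k j
... | e , w = false , e , w
R (mkL k j true) with Rpos k j
... | e , w = true , e , (mkL k j true ∷ w ++ mkL k (suc j) true ∷ [])

Draw : Word → List SMon
Draw [] = []
Draw (a ∷ w) with R a
... | s , e , v = (s , e , v ++ shift w)
                ∷ map (λ { (s' , e' , v') → s' , e' , a ∷ v' }) (Draw w)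

-- Elements of E = K[q][F(S)], as finite formal sums of terms c q^e w,
-- the q-derivative D, and the evaluation φ (x_j ↦ x, y_j ↦ y).
-- A Laurent polynomial in K[q][x^{±1}, y^{±1}] is given by its
-- coefficient function  (q-exponent, x-exponent, y-exponent) ↦ coefficient.

module _ {c ℓ : Level} (K : CommutativeRing c ℓ) where
  open CommutativeRing K renaming (_+_ to _+ᴷ_; -_ to -ᴷ_)

  Elem : Set c
  Elem = List (Carrier × ℕ × Word)

  Dterm : Carrier × ℕ × Word → Elem
  Dterm (k , e , w) =
    map (λ { (s , r , v) → (if s then -ᴷ k else k) , e + r , AIO v }) (Draw w)

  D : Elem → Elem
  D = concatMap Dterm

  D^ : ℕ → Elem → Elem
  D^ zero u = u
  D^ (suc n) u = D (D^ n u)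

  x₀ : Elem
  x₀ = (1# , 0 , mkL xK 0 false ∷ []) ∷ []

  expo : Kind → Word → ℤ
  expo k [] = + 0
  expo xK (mkL xK _ false ∷ w) = expo xK w ℤ.+ + 1
  expo xK (mkL xK _ true  ∷ w) = expo xK w ℤ.- + 1
  expo xK (mkL yK _ _     ∷ w) = expo xK w
  expo yK (mkL yK _ false ∷ w) = expo yK w ℤ.+ + 1
  expo yK (mkL yK _ true  ∷ w) = expo yK w ℤ.- + 1
  expo yK (mkL xK _ _     ∷ w) = expo yK w

  LaurentPoly : Set c
  LaurentPoly = ℕ → ℤ → ℤ → Carrier

  φ : Elem → LaurentPoly
  φ u a b d = foldr (λ { (k , e , w) acc →
      (if (e ≡ᵇ a) ∧ does (expo xK w ℤ.≟ b) ∧ does (expo yK w ℤ.≟ d)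
        then k else 0#) +ᴷ acc }) 0# u

  ι : ℕ → Carrier
  ι zero = 0#
  ι (suc m) = 1# +ᴷ ι m

  CharacteristicZero : Set ℓ
  CharacteristicZero = ∀ m → ι m ≈ 0# → m ≡ 0

data BTree : Set where
  empty : BTree
  node  : BTree → ℕ → BTree → BTree

labels : BTree → List ℕ
labels empty = []
labels (node l v r) = v ∷ labels l ++ labels r

elem : ℕ → List ℕ → Bool
elem i xs = any (i ≡ᵇ_) xs

isLabellingOf : ℕ → BTree → Bool
isLabellingOf n t =
  (length (labels t) ≡ᵇ n) ∧ all (λ i → elem i (labels t)) (map suc (upTo n))

rootAbove : ℕ → BTree → Bool
rootAbove v empty = true
rootAbove v (node _ w _) = v <ᵇ w

increasing : BTree → Bool
increasing empty = true
increasing (node l v r) =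
  rootAbove v l ∧ rootAbove v r ∧ increasing l ∧ increasing r

maxLabel : BTree → ℕ
maxLabel empty = 0
maxLabel (node l v r) = v ⊔ maxLabel l ⊔ maxLabel r

isEmpty : BTree → Bool
isEmpty empty = true
isEmpty (node _ _ _) = false

andreCond : BTree → Bool
andreCond empty = true
andreCond (node l v r) =
  ((isEmpty l ∧ isEmpty r) ∨ (maxLabel l <ᵇ maxLabel r))
  ∧ andreCond l ∧ andreCond r

-- increasing binary tree on [n] (root is then necessarily 1) satisfying the André I condition
isAndreI : ℕ → BTree → Bool
isAndreI n t = isLabellingOf n t ∧ increasing t ∧ andreCond t

leaves : BTree → ℕ
leaves empty = 0
leaves (node empty _ empty) = 1
leaves (node l _ r) = leaves l + leaves r

unary : BTree → ℕ
unary empty = 0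
unary (node l _ r) =
  (if isEmpty l ∧ not (isEmpty r) ∨ isEmpty r ∧ not (isEmpty l) then 1 else 0)
  + unary l + unary r

subtreeAt : BTree → ℕ → Maybe BTree
subtreeAt empty v = nothing
subtreeAt t@(node l w r) v with w ≡ᵇ v
... | true = just t
... | false with subtreeAt l v
...   | just s = just s
...   | nothing = subtreeAt r v

inLeftSubtreeOf : BTree → ℕ → ℕ → Bool
inLeftSubtreeOf t v i with subtreeAt t v
... | just (node l _ _) = elem i (labels l)
... | _ = false

inRightSubtreeOf : BTree → ℕ → ℕ → Bool
inRightSubtreeOf t v j with subtreeAt t v
... | just (node _ _ r) = elem j (labels r)
... | _ = false

leftChild : BTree → ℕ → Maybe ℕ
leftChild t v with subtreeAt t v
... | just (node (node _ c _) _ _) = just c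
... | _ = nothing

path : BTree → ℕ → List ℕ
path empty i = []
path (node l v r) i =
  if v ≡ᵇ i then v ∷ []
  else if elem i (labels l) then v ∷ path l i
  else if elem i (labels r) then v ∷ path r i
  else []

invPair : BTree → ℕ → ℕ → Bool
invPair t i j =
  (j <ᵇ i) ∧
  ( ( not (elem j (path t i))
      ∧ any (λ v → inLeftSubtreeOf t v i ∧ inRightSubtreeOf t v j) (path t i) )
  ∨ ( elem j (path t i)
      ∧ onPath (leftChild t j) ) )
  where
  onPath : Maybe ℕ → Bool
  onPath (just c) = elem c (path t i)
  onPath nothing = false

count : {A : Set} → (A → Bool) → List A → ℕ
count p [] = 0
count p (a ∷ as) = (if p a then 1 else 0) + count p as

inv : BTree → ℕ
inv t = foldr (λ i acc → count (invPair t i) (labels t) + acc) 0 (labels t)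

-- André I trees on [n] contributing the monomial q^a x^b y^d to E^I_n(q;x,y)
AndreITreesWith : ℕ → ℕ → ℤ → ℤ → Set
AndreITreesWith n a b d =
  Σ BTree (λ t → (isAndreI n t ≡ true) × (inv t ≡ a)
                 × (+ leaves t ≡ b) × (+ unary t ≡ d))

-- Every word of Dⁿ(x₀) has strictly increasing indices, so AIO never moves a letter, and applying D
-- to a word shifted k times yields an extra factor q^k.  Since D x₀ = x₀ y₁ and D y₀ = x₀, the steps
-- after the first one act either on the x₀-part (A) or on the y₁-part (B), and a B-step is charged an
-- extra q for y₁ itself and one for every earlier A-step.  A term of Dⁿ(x₀) is therefore a shuffle of
-- A's and B's, a term of Dᵏ(x₀) and a term of Dᵐ(y₀).  Reading the A-part as right subtree and the
-- B-part as left subtree (y₀ being the empty tree), the shuffle distributes the non-root labels, the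
-- largest always going right: this is the André I condition.  The extra powers of q count exactly
-- the inversions between the two subtrees and those of the left subtree with the root.

module Submission where

open import Defs
open import Level using (Level)
open import Algebra.Bundles using (CommutativeRing)
open import Axiom.UniquenessOfIdentityProofs.WithK using (uip)
import Data.Bool as Bool
open import Data.Bool using (Bool; true; false; if_then_else_; _∧_; _∨_; not)
open import Data.Bool.ListAction using (any; all)
open import Data.Bool.Properties using (∧-conicalˡ; ∧-conicalʳ; ∧-zeroʳ; ∧-identityʳ)
open import Data.Empty using (⊥-elim)
open import Data.Fin using (Fin; zero; suc)
open import Data.Integer using (ℤ)
import Data.Integer as ℤ
import Data.Integer.Properties as ℤₚ
open import Data.List
  using (List; []; _∷_; _++_; map; concatMap; filter; foldr; length; lookup; upTo; applyUpTo)
open import Data.List.Properties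
  using (map-id; map-++; map-∘; map-cong; ++-assoc; concatMap-map; map-concatMap; concatMap-cong;
         map-upTo; length-applyUpTo; ∷-injectiveˡ)
open import Data.List.Membership.Propositional using (_∈_; _∉_)
open import Data.List.Membership.Propositional.Properties
  using (∈-map⁺; ∈-map⁻; ∈-++⁺ˡ; ∈-++⁺ʳ; ∈-++⁻; ∈-∃++; ∈-concatMap⁺; ∈-lookup; ∈-filter⁺; ∈-filter⁻)
open import Data.List.Relation.Binary.Permutation.Propositional
  using (_↭_; prep; ↭-sym; ↭-trans; ↭-refl; ↭-reflexive; ↭⇒↭ₛ)
import Data.List.Relation.Binary.Permutation.Propositional.Properties as Perm
open Perm using (All-resp-↭; ∈-resp-↭; ↭-length; drop-∷; ++⁺; ++⁺ˡ; ++⁺ʳ; ↭-singleton-inv; ¬x∷xs↭[])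
import Data.List.Relation.Binary.Permutation.Setoid.Properties as SetoidPerm
open import Data.List.Relation.Unary.All as All using (All; []; _∷_)
import Data.List.Relation.Unary.All.Properties as Allₚ
open import Data.List.Relation.Unary.AllPairs as AllPairs using (AllPairs; []; _∷_)
import Data.List.Relation.Unary.AllPairs.Properties as AllPairsₚ
open import Data.List.Relation.Unary.Any as Any using (here; there; index)
open import Data.List.Relation.Unary.Any.Properties using (lookup-index)
open import Data.List.Relation.Unary.Unique.Propositional using (Unique)
import Data.List.Relation.Unary.Unique.Propositional.Properties as Uniqueₚ
open import Data.Maybe using (Maybe; just; nothing)
open import Data.Nat using (ℕ; zero; suc; _+_; _*_; _≤_; _<_; z≤n; s≤s; _≤ᵇ_; _<ᵇ_; _≡ᵇ_; _⊔_)
open import Data.Nat.Properties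
open import Data.Nat.Solver using (module +-*-Solver)
open import Data.Product using (Σ; ∃; _×_; _,_; proj₁; proj₂)
open import Data.Sum using (inj₁; inj₂)
open import Data.Vec using (Vec; []; _∷_; toList; last)
open import Function using (_∘_)
open import Function.Bundles using (_↔_; mk↔ₛ′)
open import Relation.Binary.PropositionalEquality
open import Relation.Nullary using (¬_; does)
open import Relation.Nullary.Decidable using (Dec; yes; dec-true)

-- The charge on a B-step comes from a twisted Leibniz rule: D(uw) consists of D(u) followed by the
-- shift of w, and of u followed by D(w). An A-step therefore shifts the whole y-part once more, so
-- a B-step after i A-steps costs q^(i+1), one factor being due to the starting index of `y₁`.
-- Distinct summands may have the same monomial: q x² y occurs twice in the image of D³(x₀). Every
-- summand is therefore indexed by its own history, a `Term`, and a coefficient becomes a number of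
-- histories. A step of D does not simply insert a new largest leaf: after a B-step the label that
-- was largest, until then on the right, goes to the left. So trees are not grown along with the
-- derivative. A finished term is turned into a tree from the root downwards, all labels being
-- supplied in increasing order, and this is inverted by recursion on the tree.

-- Shuffle n k m: words of length n with k letters A and m letters B.
data Shuffle : ℕ → ℕ → ℕ → Set where
  []  : Shuffle 0 0 0
  A∷_ : ∀ {n k m} → Shuffle n k m → Shuffle (suc n) (suc k) m
  B∷_ : ∀ {n k m} → Shuffle n k m → Shuffle (suc n) k (suc m)

snocA : ∀ {n k m} → Shuffle n k m → Shuffle (suc n) (suc k) m
snocA []     = A∷ []
snocA (A∷ s) = A∷ snocA s
snocA (B∷ s) = B∷ snocA s

snocB : ∀ {n k m} → Shuffle n k m → Shuffle (suc n) k (suc m)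
snocB []     = B∷ []
snocB (A∷ s) = A∷ snocB s
snocB (B∷ s) = B∷ snocB s

-- The derivative appends letters at the end of a shuffle, while labels are dealt out from its
-- beginning. This view exposes the last letter of a shuffle stored from the front.
data Unsnoc (n : ℕ) : ℕ → ℕ → Set where
  lastA : ∀ {k m} → Shuffle n k m → Unsnoc n (suc k) m
  lastB : ∀ {k m} → Shuffle n k m → Unsnoc n k (suc m)

A∷ᵘ_ : ∀ {n k m} → Unsnoc n k m → Unsnoc (suc n) (suc k) m
A∷ᵘ lastA s = lastA (A∷ s)
A∷ᵘ lastB s = lastB (A∷ s)

B∷ᵘ_ : ∀ {n k m} → Unsnoc n k m → Unsnoc (suc n) k (suc m)
B∷ᵘ lastA s = lastA (B∷ s)
B∷ᵘ lastB s = lastB (B∷ s)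

unsnoc : ∀ {n k m} → Shuffle (suc n) k m → Unsnoc n k m
unsnoc {zero}  (A∷ []) = lastA []
unsnoc {zero}  (B∷ []) = lastB []
unsnoc {suc n} (A∷ s)  = A∷ᵘ unsnoc s
unsnoc {suc n} (B∷ s)  = B∷ᵘ unsnoc s

unsnoc-snocA : ∀ {n k m} (s : Shuffle n k m) → unsnoc (snocA s) ≡ lastA s
unsnoc-snocA []     = refl
unsnoc-snocA (A∷ s) = cong A∷ᵘ_ (unsnoc-snocA s)
unsnoc-snocA (B∷ s) = cong B∷ᵘ_ (unsnoc-snocA s)

unsnoc-snocB : ∀ {n k m} (s : Shuffle n k m) → unsnoc (snocB s) ≡ lastB s
unsnoc-snocB []     = refl
unsnoc-snocB (A∷ s) = cong A∷ᵘ_ (unsnoc-snocB s)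
unsnoc-snocB (B∷ s) = cong B∷ᵘ_ (unsnoc-snocB s)

snoc : ∀ {n k m} → Unsnoc n k m → Shuffle (suc n) k m
snoc (lastA s) = snocA s
snoc (lastB s) = snocB s

snoc-A∷ᵘ : ∀ {n k m} (u : Unsnoc n k m) → snoc (A∷ᵘ u) ≡ A∷ snoc u
snoc-A∷ᵘ (lastA s) = refl
snoc-A∷ᵘ (lastB s) = refl

snoc-B∷ᵘ : ∀ {n k m} (u : Unsnoc n k m) → snoc (B∷ᵘ u) ≡ B∷ snoc u
snoc-B∷ᵘ (lastA s) = refl
snoc-B∷ᵘ (lastB s) = refl

snoc-unsnoc : ∀ {n k m} (s : Shuffle (suc n) k m) → snoc (unsnoc s) ≡ s
snoc-unsnoc {zero}  (A∷ []) = refl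
snoc-unsnoc {zero}  (B∷ []) = refl
snoc-unsnoc {suc n} (A∷ s)  = trans (snoc-A∷ᵘ (unsnoc s)) (cong A∷_ (snoc-unsnoc s))
snoc-unsnoc {suc n} (B∷ s)  = trans (snoc-B∷ᵘ (unsnoc s)) (cong B∷_ (snoc-unsnoc s))

-- Pairs consisting of an A and a later B.
invs : ∀ {n k m} → Shuffle n k m → ℕ
invs []             = 0
invs (A∷_ {m = m} s) = m + invs s
invs (B∷ s)         = invs s

invs-snocA : ∀ {n k m} (s : Shuffle n k m) → invs (snocA s) ≡ invs s
invs-snocA []     = refl
invs-snocA (A∷_ {m = m} s) = cong (m +_) (invs-snocA s)
invs-snocA (B∷ s) = invs-snocA s

-- A final B comes after all `k` letters A and forms a pair with each of them; a final A has no
-- later B.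
invs-snocB : ∀ {n k m} (s : Shuffle n k m) → invs (snocB s) ≡ invs s + k
invs-snocB []     = refl
invs-snocB (A∷_ {k = k} {m = m} s) = trans (cong (suc m +_) (invs-snocB s))
  (solve 3 (λ m i k → con 1 :+ m :+ (i :+ k) := m :+ i :+ (con 1 :+ k)) refl m (invs s) k)
  where open +-*-Solver
invs-snocB (B∷ s) = invs-snocB s

length-split : ∀ {n k m} → Shuffle n k m → n ≡ k + m
length-split []                      = refl
length-split (A∷ s)                  = cong suc (length-split s)
length-split (B∷_ {k = k} {m = m} s) = trans (cong suc (length-split s)) (sym (+-suc k m))

-- Histories of the derivative

-- Term xK n indexes the terms of Dⁿ(x₀) and Term yK n those of Dⁿ(y₀).
data Term : Kind → ℕ → Set where
  xleaf : Term xK 0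
  yleaf : Term yK 0
  toX   : ∀ {m} → Term xK m → Term yK (suc m)
  bin   : ∀ {n k m} → Shuffle n k m → Term xK k → Term yK m → Term xK (suc n)

-- children t is, in the order of Draw, the list of terms that one more application of D makes of t.
children : ∀ {κ n} → Term κ n → List (Term κ (suc n))
children xleaf       = bin [] xleaf yleaf ∷ []
children yleaf       = toX xleaf ∷ []
children (toX t)     = map toX (children t)
children (bin s r l) = map (λ r′ → bin (snocA s) r′ l) (children r)
                    ++ map (λ l′ → bin (snocB s) r l′) (children l)

-- Undoes the last step. Each term lies among the children of its parent and of no other term, which
-- makes the enumeration `terms` complete and free of repetitions.
parent : ∀ {κ n} → Term κ (suc n) → Term κ n
parentBin : ∀ {n k m} → Unsnoc n k m → Term xK k → Term yK m → Term xK (suc n)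
-- A bare x₀ inside `toX` is the result of the step from y₀ to x₀; if the inner term is larger, the
-- last step took place inside it.
parent (toX xleaf)             = yleaf
parent (toX t@(bin _ _ _))     = toX (parent t)
parent (bin {zero} s r l)      = xleaf
parent (bin {suc n} s r l)     = parentBin (unsnoc s) r l
parentBin (lastA s) r l = bin s (parent r) l
parentBin (lastB s) r l = bin s r (parent l)

∈-children-parent : ∀ {κ n} (t : Term κ (suc n)) → t ∈ children (parent t)
∈-children-parentBin : ∀ {n k m} (u : Unsnoc n k m) (r : Term xK k) (l : Term yK m) →
  bin (snoc u) r l ∈ children (parentBin u r l)
∈-children-parent (toX xleaf)                  = here refl
∈-children-parent (toX t@(bin _ _ _))          = ∈-map⁺ toX (∈-children-parent t)
∈-children-parent (bin {zero} [] xleaf yleaf) = here refl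
∈-children-parent (bin {suc n} s r l)          =
  subst (λ s′ → bin s′ r l ∈ children (parentBin (unsnoc s) r l)) (snoc-unsnoc s)
        (∈-children-parentBin (unsnoc s) r l)
∈-children-parentBin (lastA s) r l = ∈-++⁺ˡ (∈-map⁺ _ (∈-children-parent r))
∈-children-parentBin (lastB s) r l = ∈-++⁺ʳ _ (∈-map⁺ _ (∈-children-parent l))

parent-child : ∀ {κ n} (p : Term κ n) {t} → t ∈ children p → parent t ≡ p
parent-child xleaf   (here refl) = refl
parent-child yleaf   (here refl) = refl
parent-child (toX p) t∈ with ∈-map⁻ toX t∈
... | bin s r l , t′∈ , refl = cong toX (parent-child p t′∈)
parent-child (bin s r l) t∈ with ∈-++⁻ (map _ (children r)) t∈
... | inj₁ t∈r with ∈-map⁻ _ t∈r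
...   | r′ , r′∈ , refl rewrite unsnoc-snocA s = cong (λ r → bin s r l) (parent-child r r′∈)
parent-child (bin s r l) t∈ | inj₂ t∈l with ∈-map⁻ _ t∈l
...   | l′ , l′∈ , refl rewrite unsnoc-snocB s = cong (bin s r) (parent-child l l′∈)

toX-injective : ∀ {m} {t u : Term xK m} → toX t ≡ toX u → t ≡ u
toX-injective refl = refl

bin-injectiveʳ : ∀ {n k m} {s : Shuffle n k m} {r r′ l} → bin s r l ≡ bin s r′ l → r ≡ r′
bin-injectiveʳ refl = refl

bin-injectiveˡ : ∀ {n k m} {s : Shuffle n k m} {r l l′} → bin s r l ≡ bin s r l′ → l ≡ l′
bin-injectiveˡ refl = refl

-- Tells the two kinds of step apart: an A-step raises this number, a B-step keeps it.
rightSize : ∀ {n} → Term xK (suc n) → ℕ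
rightSize (bin {k = k} _ _ _) = k

children-unique : ∀ {κ n} (p : Term κ n) → Unique (children p)
children-unique xleaf       = [] ∷ []
children-unique yleaf       = [] ∷ []
children-unique (toX p)     = Uniqueₚ.map⁺ toX-injective (children-unique p)
children-unique (bin s r l) = Uniqueₚ.++⁺
  (Uniqueₚ.map⁺ bin-injectiveʳ (children-unique r))
  (Uniqueₚ.map⁺ bin-injectiveˡ (children-unique l))
  λ (t∈r , t∈l) → disjoint (∈-map⁻ _ t∈r) (∈-map⁻ _ t∈l)
  where
  disjoint : ∀ {t} → (∃ λ r′ → r′ ∈ children r × t ≡ bin (snocA s) r′ l) →
             ¬ (∃ λ l′ → l′ ∈ children l × t ≡ bin (snocB s) r l′)
  disjoint (_ , _ , refl) (_ , _ , eq) with cong rightSize eq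
  ... | ()

terms : ∀ n → List (Term xK n)
terms zero    = xleaf ∷ []
terms (suc n) = concatMap children (terms n)

terms-complete : ∀ {n} (t : Term xK n) → t ∈ terms n
terms-complete {zero}  xleaf = here refl
terms-complete {suc n} t     =
  ∈-concatMap⁺ children (Any.map (λ { refl → ∈-children-parent t }) (terms-complete (parent t)))

terms-unique : ∀ n → Unique (terms n)
terms-unique zero    = [] ∷ []
terms-unique (suc n) = Uniqueₚ.concat⁺
  (Allₚ.map⁺ (All.universal children-unique (terms n)))
  (AllPairsₚ.map⁺ (AllPairs.map disjoint (terms-unique n)))
  where
  disjoint : ∀ {p q : Term xK n} → p ≢ q → ∀ {t} → ¬ (t ∈ children p × t ∈ children q)
  disjoint p≢q (t∈p , t∈q) = p≢q (trans (sym (parent-child _ t∈p)) (parent-child _ t∈q))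

-- Words and the q-derivative

up : Letter → Letter
up (mkL k i s) = mkL k (suc i) s

shift-++ : ∀ u w → shift (u ++ w) ≡ shift u ++ shift w
shift-++ = map-++ _

shiftBy : ℕ → Word → Word
shiftBy zero    w = w
shiftBy (suc k) w = shift (shiftBy k w)

consS : Letter → SMon → SMon
consS a (s , e , v) = s , e , a ∷ v

appendS : Word → SMon → SMon
appendS w (s , e , v) = s , e , v ++ shift w

prependS : Word → SMon → SMon
prependS u (s , e , v) = s , e , u ++ v

shiftS : ℕ → SMon → SMon
shiftS k (s , e , v) = s , k + e , shiftBy k v

scaleS : ℕ → SMon → SMon
scaleS c (s , e , v) = s , c + e , v

Draw-∷ : ∀ a w → Draw (a ∷ w) ≡ appendS w (R a) ∷ map (consS a) (Draw w)
Draw-∷ a w with R a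
... | s , e , v = cong (_ ∷_) (map-cong (λ _ → refl) (Draw w))

-- The twisted Leibniz rule: a step in the front part shifts everything behind it, a step in the
-- rear part leaves the front unchanged. It is stated for `Draw`, that is, before sorting.
Draw-++ : ∀ u w → Draw (u ++ w) ≡ map (appendS w) (Draw u) ++ map (prependS u) (Draw w)
Draw-++ []      w = sym (trans (map-cong (λ _ → refl) (Draw w)) (map-id (Draw w)))
Draw-++ (a ∷ u) w = begin
  Draw (a ∷ u ++ w)
    ≡⟨ Draw-∷ a (u ++ w) ⟩
  appendS (u ++ w) (R a) ∷ map (consS a) (Draw (u ++ w))
    ≡⟨ cong₂ _∷_ (cong (λ v → proj₁ (R a) , proj₁ (proj₂ (R a)) , v)
         (trans (cong (Ra ++_) (shift-++ u w)) (sym (++-assoc Ra (shift u) (shift w)))))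
         (trans (cong (map (consS a)) (Draw-++ u w)) (map-++ (consS a) (map (appendS w) (Draw u)) _)) ⟩
  appendS w (appendS u (R a))
    ∷ map (consS a) (map (appendS w) (Draw u)) ++ map (consS a) (map (prependS u) (Draw w))
    ≡⟨ cong (appendS w (appendS u (R a)) ∷_)
         (cong₂ _++_ (trans (sym (map-∘ (Draw u))) (map-∘ (Draw u))) (sym (map-∘ (Draw w)))) ⟩
  appendS w (appendS u (R a)) ∷ map (appendS w) (map (consS a) (Draw u)) ++ map (prependS (a ∷ u)) (Draw w)
    ≡⟨ cong (λ z → map (appendS w) z ++ map (prependS (a ∷ u)) (Draw w)) (sym (Draw-∷ a u)) ⟩
  map (appendS w) (Draw (a ∷ u)) ++ map (prependS (a ∷ u)) (Draw w) ∎
  where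
  open ≡-Reasoning
  Ra = proj₂ (proj₂ (R a))

R-up : ∀ a → R (up a) ≡ shiftS 1 (R a)
R-up (mkL xK j false) = refl
R-up (mkL xK j true)  = refl
R-up (mkL yK j false) = refl
R-up (mkL yK j true)  = refl

Draw-shift : ∀ w → Draw (shift w) ≡ map (shiftS 1) (Draw w)
Draw-shift []      = refl
Draw-shift (a ∷ w) = begin
  Draw (up a ∷ shift w)
    ≡⟨ Draw-∷ (up a) (shift w) ⟩
  appendS (shift w) (R (up a)) ∷ map (consS (up a)) (Draw (shift w))
    ≡⟨ cong₂ _∷_ (trans (cong (appendS (shift w)) (R-up a))
                        (cong (λ v → proj₁ (R a) , suc (proj₁ (proj₂ (R a))) , v)
                              (sym (shift-++ (proj₂ (proj₂ (R a))) (shift w)))))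
                 (trans (cong (map (consS (up a))) (Draw-shift w))
                        (trans (sym (map-∘ (Draw w))) (map-∘ (Draw w)))) ⟩
  shiftS 1 (appendS w (R a)) ∷ map (shiftS 1) (map (consS a) (Draw w))
    ≡⟨ cong (map (shiftS 1)) (sym (Draw-∷ a w)) ⟩
  map (shiftS 1) (Draw (a ∷ w)) ∎
  where open ≡-Reasoning

Draw-shiftBy : ∀ k w → Draw (shiftBy k w) ≡ map (shiftS k) (Draw w)
Draw-shiftBy zero    w = sym (trans (map-cong (λ _ → refl) (Draw w)) (map-id (Draw w)))
Draw-shiftBy (suc k) w = trans (Draw-shift (shiftBy k w))
  (trans (cong (map (shiftS 1)) (Draw-shiftBy k w)) (sym (map-∘ (Draw w))))

-- The left part is shifted `suc k` times: once because it starts as `y₁`, and once for each of the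
-- `k` A-steps.
word : ∀ {κ n} → Term κ n → Word
word xleaf               = mkL xK 0 false ∷ []
word yleaf               = mkL yK 0 false ∷ []
word (toX t)             = word t
word (bin {k = k} s r l) = word r ++ shiftBy (suc k) (word l)

expQ : ∀ {κ n} → Term κ n → ℕ
expQ xleaf               = 0
expQ yleaf               = 0
expQ (toX t)             = expQ t
expQ (bin {m = m} s r l) = expQ r + (expQ l + (invs s + m))

signed : ∀ {κ n} → Term κ n → SMon
signed t = false , expQ t , word t

-- The Leibniz rule separates the steps on the right part from those on the left part, and the
-- induction hypotheses apply to each. Both sides agree as lists, so no sum has to be rearranged.
Draw-word : ∀ {κ n} (t : Term κ n) → map (scaleS (expQ t)) (Draw (word t)) ≡ map signed (children t)
Draw-word xleaf   = refl
Draw-word yleaf   = refl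
Draw-word (toX t) = trans (Draw-word t) (map-∘ (children t))
Draw-word (bin {k = k} {m} s r l) = begin
  map (scaleS E) (Draw (word r ++ W))
    ≡⟨ cong (map (scaleS E)) (trans (Draw-++ (word r) W)
         (cong (λ z → map (appendS W) (Draw (word r)) ++ map (prependS (word r)) z)
               (Draw-shiftBy (suc k) (word l)))) ⟩
  map (scaleS E) (map (appendS W) (Draw (word r))
    ++ map (prependS (word r)) (map (shiftS (suc k)) (Draw (word l))))
    ≡⟨ map-++ (scaleS E) (map (appendS W) (Draw (word r))) _ ⟩
  map (scaleS E) (map (appendS W) (Draw (word r)))
    ++ map (scaleS E) (map (prependS (word r)) (map (shiftS (suc k)) (Draw (word l))))
    ≡⟨ cong₂ _++_ right left ⟩
  map signed (map (λ r′ → bin (snocA s) r′ l) (children r))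
    ++ map signed (map (λ l′ → bin (snocB s) r l′) (children l))
    ≡⟨ map-++ signed (map _ (children r)) _ ⟨
  map signed (children (bin s r l)) ∎
  where
  open ≡-Reasoning
  open +-*-Solver
  E = expQ (bin s r l)
  W = shiftBy (suc k) (word l)
  C = expQ l + (invs s + m)

  -- An A-step leaves the cost `C` of the left part and of the shuffle unchanged and shifts the left
  -- word once more.
  F : SMon → SMon
  F (b , e , v) = b , e + C , v ++ shift W

  -- The additional `suc k` is the price of a B-step taken after `k` A-steps: `k` new pairs in the
  -- shuffle and one more letter B.
  G : SMon → SMon
  G (b , e , v) = b , expQ r + (e + (invs s + m + suc k)) , word r ++ shiftBy (suc k) v

  right : map (scaleS E) (map (appendS W) (Draw (word r)))
          ≡ map signed (map (λ r′ → bin (snocA s) r′ l) (children r))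
  right = begin
    map (scaleS E) (map (appendS W) (Draw (word r)))
      ≡⟨ trans (sym (map-∘ (Draw (word r))))
           (trans (map-cong (λ (b , e , v) → cong (λ z → b , z , v ++ shift W)
              (solve 3 (λ x c e → x :+ c :+ e := x :+ e :+ c) refl (expQ r) C e)) (Draw (word r)))
             (map-∘ (Draw (word r)))) ⟩
    map F (map (scaleS (expQ r)) (Draw (word r)))
      ≡⟨ cong (map F) (Draw-word r) ⟩
    map F (map signed (children r))
      ≡⟨ trans (sym (map-∘ (children r)))
           (trans (map-cong (λ r′ → cong (λ z → false , expQ r′ + (expQ l + (z + m)) , word r′ ++ shift W)
                              (sym (invs-snocA s))) (children r))
                  (map-∘ (children r))) ⟩
    map signed (map (λ r′ → bin (snocA s) r′ l) (children r)) ∎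

  left : map (scaleS E) (map (prependS (word r)) (map (shiftS (suc k)) (Draw (word l))))
         ≡ map signed (map (λ l′ → bin (snocB s) r l′) (children l))
  left = begin
    map (scaleS E) (map (prependS (word r)) (map (shiftS (suc k)) (Draw (word l))))
      ≡⟨ trans (cong (map (scaleS E)) (sym (map-∘ (Draw (word l))))) (trans (sym (map-∘ (Draw (word l))))
           (trans (map-cong (λ (b , e , v) → cong (λ z → b , z , word r ++ shiftBy (suc k) v)
              (solve 5 (λ x y i k e →
                   x :+ (y :+ i) :+ (con 1 :+ k :+ e) := x :+ (y :+ e :+ (i :+ (con 1 :+ k))))
                 refl (expQ r) (expQ l) (invs s + m) k e)) (Draw (word l)))
             (map-∘ (Draw (word l))))) ⟩
    map G (map (scaleS (expQ l)) (Draw (word l)))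
      ≡⟨ cong (map G) (Draw-word l) ⟩
    map G (map signed (children l))
      ≡⟨ trans (sym (map-∘ (children l)))
           (trans (map-cong (λ l′ → cong (λ z → false , expQ r + (expQ l′ + z) , word r ++ shiftBy (suc k) (word l′))
                              (trans (solve 3 (λ i m k → i :+ m :+ (con 1 :+ k) := i :+ k :+ (con 1 :+ m))
                                        refl (invs s) m k)
                                     (cong (_+ suc m) (sym (invs-snocB s))))) (children l))
                  (map-∘ (children l))) ⟩
    map signed (map (λ l′ → bin (snocB s) r l′) (children l)) ∎

-- Words of terms are already sorted

All-index-shift : ∀ {P : ℕ → Set} w → All (P ∘ suc ∘ Letter.index) w → All (P ∘ Letter.index) (shift w)
All-index-shift []      []       = []
All-index-shift (a ∷ w) (p ∷ ps) = p ∷ All-index-shift w ps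

All-index-shiftBy : ∀ {P : ℕ → Set} k w → All (P ∘ (k +_) ∘ Letter.index) w → All (P ∘ Letter.index) (shiftBy k w)
All-index-shiftBy zero    w ps = ps
All-index-shiftBy {P} (suc k) w ps = All-index-shift (shiftBy k w) (All-index-shiftBy {P ∘ suc} k w ps)

Ascending : Word → Set
Ascending = AllPairs (λ a b → Letter.index a < Letter.index b)

Ascending-shiftBy : ∀ k {w} → Ascending w → Ascending (shiftBy k w)
Ascending-shiftBy zero    p = p
Ascending-shiftBy (suc k) p = AllPairsₚ.map⁺ (AllPairs.map s≤s (Ascending-shiftBy k p))

-- In a `bin` the right part has indices at most `k`, while those of the left part start at `suc k`.
-- This gap is what makes the concatenated word ascending.
index-bound : ∀ {κ n} (t : Term κ n) → All (λ a → Letter.index a ≤ n) (word t)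
index-bound xleaf   = z≤n ∷ []
index-bound yleaf   = z≤n ∷ []
index-bound (toX t) = All.map m≤n⇒m≤1+n (index-bound t)
index-bound (bin {n} {k} {m} s r l) = Allₚ.++⁺
  (All.map (λ i≤k → m≤n⇒m≤1+n (≤-trans i≤k k≤n)) (index-bound r))
  (All-index-shiftBy {_≤ suc n} (suc k) (word l)
    (All.map (λ i≤m → s≤s (≤-trans (+-monoʳ-≤ k i≤m) (≤-reflexive (sym (length-split s)))))
             (index-bound l)))
  where k≤n = ≤-trans (m≤m+n k m) (≤-reflexive (sym (length-split s)))

word-ascending : ∀ {κ n} (t : Term κ n) → Ascending (word t)
word-ascending xleaf   = [] ∷ []
word-ascending yleaf   = [] ∷ []
word-ascending (toX t) = word-ascending t
word-ascending (bin {k = k} s r l) = AllPairsₚ.++⁺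
  (word-ascending r) (Ascending-shiftBy (suc k) (word-ascending l))
  (All.map (λ {a} i≤k → All-index-shiftBy {Letter.index a <_} (suc k) (word l)
      (All.universal (λ b → s≤s (≤-trans i≤k (m≤m+n k _))) (word l))) (index-bound r))

key-mono : ∀ a b → Letter.index a < Letter.index b → key a ≤ key b
key-mono a b i<j = ≤-trans (upper a) (≤-trans (*-monoʳ-≤ 2 i<j) (lower b))
  where
  upper : ∀ a → key a ≤ 2 * suc (Letter.index a)
  upper (mkL xK i _) = *-monoʳ-≤ 2 (n≤1+n i)
  upper (mkL yK i _) = ≤-trans (n≤1+n _) (≤-reflexive (sym (*-suc 2 i)))
  lower : ∀ b → 2 * Letter.index b ≤ key b
  lower (mkL xK j _) = ≤-refl
  lower (mkL yK j _) = n≤1+n _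

≤ᵇ-true : ∀ {m n} → m ≤ n → (m ≤ᵇ n) ≡ true
≤ᵇ-true {m} {n} m≤n with m ≤ᵇ n | ≤⇒≤ᵇ m≤n
... | true | _ = refl

AIO-ascending : ∀ {w} → Ascending w → AIO w ≡ w
AIO-ascending []                        = refl
AIO-ascending {a ∷ []} ([] ∷ [])        = refl
AIO-ascending {a ∷ b ∷ w} ((p ∷ _) ∷ q) rewrite AIO-ascending q | ≤ᵇ-true (key-mono a b p) = refl

-- Expansion of the iterated derivative

module _ {c ℓ : Level} (K : CommutativeRing c ℓ) where
  open CommutativeRing K using (Carrier; 1#)

  monomial : ∀ {κ n} → Term κ n → Carrier × ℕ × Word
  monomial t = 1# , expQ t , word t

  Dterm-monomial : ∀ {κ n} (t : Term κ n) → Dterm K (monomial t) ≡ map monomial (children t)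
  Dterm-monomial t = begin
    Dterm K (monomial t)
      ≡⟨ map-∘ (Draw (word t)) ⟩
    map H (map (scaleS (expQ t)) (Draw (word t)))
      ≡⟨ cong (map H) (Draw-word t) ⟩
    map H (map signed (children t))
      ≡⟨ map-∘ (children t) ⟨
    map (H ∘ signed) (children t)
      ≡⟨ map-cong (λ u → cong (λ w → 1# , expQ u , w) (AIO-ascending (word-ascending u))) (children t) ⟩
    map monomial (children t) ∎
    where
    open ≡-Reasoning
    H : SMon → Carrier × ℕ × Word
    H (s , e , v) = (if s then CommutativeRing.-_ K 1# else 1#) , e , AIO v

  -- This is an equality of lists because `children` follows the order of `Draw`. Hence `φ` can be
  -- evaluated entry by entry, every coefficient being `1#`.
  D^-x₀ : ∀ n → D^ K n (x₀ K) ≡ map monomial (terms n)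
  D^-x₀ zero    = refl
  D^-x₀ (suc n) = begin
    D K (D^ K n (x₀ K))                        ≡⟨ cong (D K) (D^-x₀ n) ⟩
    concatMap (Dterm K) (map monomial (terms n)) ≡⟨ concatMap-map (Dterm K) monomial (terms n) ⟩
    concatMap (Dterm K ∘ monomial) (terms n)    ≡⟨ concatMap-cong Dterm-monomial (terms n) ⟩
    concatMap (map monomial ∘ children) (terms n) ≡⟨ map-concatMap monomial children (terms n) ⟨
    map monomial (terms (suc n)) ∎
    where open ≡-Reasoning

-- Boolean tests

<ᵇ-true : ∀ {m n} → m < n → (m <ᵇ n) ≡ true
<ᵇ-true {m} {n} m<n with m <ᵇ n | <⇒<ᵇ m<n
... | true | _ = refl

<ᵇ-true⁻¹ : ∀ {m n} → (m <ᵇ n) ≡ true → m < n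
<ᵇ-true⁻¹ {m} {n} eq = <ᵇ⇒< m n (subst Bool.T (sym eq) _)

<ᵇ-false : ∀ {m n} → n ≤ m → (m <ᵇ n) ≡ false
<ᵇ-false {m} {n} n≤m with m <ᵇ n in eq
... | true  = ⊥-elim (<⇒≱ (<ᵇ-true⁻¹ eq) n≤m)
... | false = refl

≡ᵇ-refl : ∀ m → (m ≡ᵇ m) ≡ true
≡ᵇ-refl zero    = refl
≡ᵇ-refl (suc m) = ≡ᵇ-refl m

≡ᵇ-true⁻¹ : ∀ {m n} → (m ≡ᵇ n) ≡ true → m ≡ n
≡ᵇ-true⁻¹ {m} {n} eq = ≡ᵇ⇒≡ m n (subst Bool.T (sym eq) _)

≡ᵇ-false : ∀ {m n} → m ≢ n → (m ≡ᵇ n) ≡ false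
≡ᵇ-false {m} {n} m≢n with m ≡ᵇ n in eq
... | true  = ⊥-elim (m≢n (≡ᵇ-true⁻¹ eq))
... | false = refl

elem-true : ∀ {i xs} → i ∈ xs → elem i xs ≡ true
elem-true {i} (here refl) rewrite ≡ᵇ-refl i = refl
elem-true {i} {x ∷ xs} (there i∈) rewrite elem-true i∈ with i ≡ᵇ x
... | true  = refl
... | false = refl

elem-true⁻¹ : ∀ {i} xs → elem i xs ≡ true → i ∈ xs
elem-true⁻¹ {i} (x ∷ xs) eq with i ≡ᵇ x in e
... | true  = here (≡ᵇ-true⁻¹ e)
... | false = there (elem-true⁻¹ xs eq)

elem-false : ∀ {i} xs → i ∉ xs → elem i xs ≡ false
elem-false {i} xs i∉ with elem i xs in eq
... | true  = ⊥-elim (i∉ (elem-true⁻¹ xs eq))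
... | false = refl

all-true : ∀ {A : Set} {p : A → Bool} {xs} → All (λ x → p x ≡ true) xs → all p xs ≡ true
all-true []       = refl
all-true (e ∷ es) rewrite e = all-true es

all-true⁻¹ : ∀ {A : Set} {p : A → Bool} xs → all p xs ≡ true → All (λ x → p x ≡ true) xs
all-true⁻¹ []       _  = []
all-true⁻¹ (x ∷ xs) eq = ∧-conicalˡ _ _ eq ∷ all-true⁻¹ xs (∧-conicalʳ _ _ eq)

any-cong : ∀ {A : Set} {f g : A → Bool} {xs} → All (λ x → f x ≡ g x) xs → any f xs ≡ any g xs
any-cong []       = refl
any-cong (e ∷ es) = cong₂ _∨_ e (any-cong es)

any-false : ∀ {A : Set} {f : A → Bool} {xs} → All (λ x → f x ≡ false) xs → any f xs ≡ false
any-false []       = refl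
any-false (e ∷ es) rewrite e = any-false es

-- Permutations

Unique-resp-↭ : ∀ {xs ys : List ℕ} → xs ↭ ys → Unique xs → Unique ys
Unique-resp-↭ p = SetoidPerm.Unique-resp-↭ (setoid ℕ) (↭⇒↭ₛ p)

∈⇒↭ : ∀ {x : ℕ} {xs} → x ∈ xs → ∃ λ ys → xs ↭ x ∷ ys
∈⇒↭ {x} x∈ with ∈-∃++ x∈
... | as , bs , refl = as ++ bs , Perm.shift x as bs

-- Pigeonhole: equal lengths leave no room in the second list for repetitions or further entries. It
-- turns the labelling test, which checks only length and occurrence, into a permutation.
unique-⊆⇒↭ : ∀ {xs ys : List ℕ} → Unique xs → (∀ {x} → x ∈ xs → x ∈ ys) →
             length ys ≡ length xs → xs ↭ ys
unique-⊆⇒↭ {[]}     {[]} _         _   _   = ↭-refl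
unique-⊆⇒↭ {x ∷ xs}      (x∉ ∷ u) sub len with ∈⇒↭ (sub (here refl))
... | ys′ , p = ↭-trans (prep x (unique-⊆⇒↭ u sub′ (suc-injective (trans (sym (↭-length p)) len)))) (↭-sym p)
  where
  sub′ : ∀ {z} → z ∈ xs → z ∈ ys′
  sub′ z∈ with ∈-resp-↭ p (sub (there z∈))
  ... | here refl = ⊥-elim (All.lookup x∉ z∈ refl)
  ... | there z∈′ = z∈′

unique-disjoint : ∀ xs {ys : List ℕ} → Unique (xs ++ ys) → ∀ {x} → x ∈ xs → x ∉ ys
unique-disjoint (x ∷ xs) (x∉ ∷ u) (here refl) x∈ys = All.lookup x∉ (∈-++⁺ʳ xs x∈ys) refl
unique-disjoint (x ∷ xs) (x∉ ∷ u) (there x∈)  x∈ys = unique-disjoint xs u x∈ x∈ys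

-- Splitting labels

Sorted : ∀ {n} → Vec ℕ n → Set
Sorted vs = AllPairs _<_ (toList vs)

-- The labels exceed the letters of the shuffle by one; the last label always goes to the right.
splitR : ∀ {n k m} → Shuffle n k m → Vec ℕ (suc n) → Vec ℕ (suc k)
splitR []     vs       = vs
splitR (A∷ s) (v ∷ vs) = v ∷ splitR s vs
splitR (B∷ s) (v ∷ vs) = splitR s vs

splitL : ∀ {n k m} → Shuffle n k m → Vec ℕ (suc n) → Vec ℕ m
splitL []     vs       = []
splitL (A∷ s) (v ∷ vs) = splitL s vs
splitL (B∷ s) (v ∷ vs) = v ∷ splitL s vs

split-↭ : ∀ {n k m} (s : Shuffle n k m) vs → toList (splitL s vs) ++ toList (splitR s vs) ↭ toList vs
split-↭ []     vs       = ↭-refl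
split-↭ (A∷ s) (v ∷ vs) = ↭-trans (Perm.shift v (toList (splitL s vs)) _) (prep v (split-↭ s vs))
split-↭ (B∷ s) (v ∷ vs) = prep v (split-↭ s vs)

All-splitL : ∀ {P : ℕ → Set} {n k m} (s : Shuffle n k m) vs → All P (toList vs) → All P (toList (splitL s vs))
All-splitL s vs ps = Allₚ.++⁻ˡ _ (All-resp-↭ (↭-sym (split-↭ s vs)) ps)

All-splitR : ∀ {P : ℕ → Set} {n k m} (s : Shuffle n k m) vs → All P (toList vs) → All P (toList (splitR s vs))
All-splitR s vs ps = Allₚ.++⁻ʳ (toList (splitL s vs)) (All-resp-↭ (↭-sym (split-↭ s vs)) ps)

Sorted-splitL : ∀ {n k m} (s : Shuffle n k m) vs → Sorted vs → Sorted (splitL s vs)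
Sorted-splitL []     vs       _        = []
Sorted-splitL (A∷ s) (v ∷ vs) (p ∷ ps) = Sorted-splitL s vs ps
Sorted-splitL (B∷ s) (v ∷ vs) (p ∷ ps) = All-splitL s vs p ∷ Sorted-splitL s vs ps

Sorted-splitR : ∀ {n k m} (s : Shuffle n k m) vs → Sorted vs → Sorted (splitR s vs)
Sorted-splitR []     vs       ps       = ps
Sorted-splitR (A∷ s) (v ∷ vs) (p ∷ ps) = All-splitR s vs p ∷ Sorted-splitR s vs ps
Sorted-splitR (B∷ s) (v ∷ vs) (p ∷ ps) = Sorted-splitR s vs ps

-- The witness is the last label, which carries no letter and stays on the right. This is the source
-- of the André I condition.
split-max : ∀ {n k m} (s : Shuffle n k m) vs → Sorted vs →
            ∃ λ M → M ∈ toList (splitR s vs) × All (_< M) (toList (splitL s vs))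
split-max []     (v ∷ []) _        = v , here refl , []
split-max (A∷ s) (v ∷ vs) (p ∷ ps) with split-max s vs ps
... | M , M∈ , <M = M , there M∈ , <M
split-max (B∷ s) (v ∷ vs) (p ∷ ps) with split-max s vs ps
... | M , M∈ , <M = M , M∈ , All.lookup p (∈-resp-↭ (split-↭ s vs) (∈-++⁺ʳ _ M∈)) ∷ <M

-- At the first place where the shuffles differ, the current label belongs to one left side while
-- everything on the other left side exceeds it. The sizes are part of the conclusion because they
-- are not known to agree beforehand.
splitL-injective : ∀ {n k m k′ m′} (s : Shuffle n k m) (s′ : Shuffle n k′ m′) vs → Sorted vs →
  toList (splitL s vs) ↭ toList (splitL s′ vs) →
  _≡_ {A = ∃ λ k → ∃ λ m → Shuffle n k m} (k , m , s) (k′ , m′ , s′)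
splitL-injective []     []      vs       _        _ = refl
splitL-injective (A∷ s) (A∷ s′) (v ∷ vs) (p ∷ ps) e with splitL-injective s s′ vs ps e
... | refl = refl
splitL-injective (B∷ s) (B∷ s′) (v ∷ vs) (p ∷ ps) e with splitL-injective s s′ vs ps (drop-∷ e)
... | refl = refl
splitL-injective (A∷ s) (B∷ s′) (v ∷ vs) (p ∷ ps) e =
  ⊥-elim (<-irrefl refl (All.lookup (All-splitL s vs p) (∈-resp-↭ (↭-sym e) (here refl))))
splitL-injective (B∷ s) (A∷ s′) (v ∷ vs) (p ∷ ps) e =
  ⊥-elim (<-irrefl refl (All.lookup (All-splitL s′ vs p) (∈-resp-↭ e (here refl))))

-- Each label but the last receives the letter of the side on which it lies. The last label has no
-- letter, so it must be known to lie on the right.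
split-surjective : ∀ {n} (vs : Vec ℕ (suc n)) xs ys → xs ++ ys ↭ toList vs → last vs ∉ xs →
  ∃ λ k → ∃ λ m → Σ (Shuffle n k m) λ s → (xs ↭ toList (splitL s vs)) × (ys ↭ toList (splitR s vs))
split-surjective (v ∷ [])     []       ys p _  = 0 , 0 , [] , ↭-refl , p
split-surjective (v ∷ [])     (x ∷ xs) ys p ∉xs =
  ⊥-elim (∉xs (here (sym (∷-injectiveˡ (↭-singleton-inv p)))))
split-surjective (v ∷ w ∷ ws) xs ys p ∉xs with ∈-++⁻ xs (∈-resp-↭ (↭-sym p) (here refl))
... | inj₁ v∈xs with ∈⇒↭ v∈xs
...   | xs′ , q with split-surjective (w ∷ ws) xs′ ys (drop-∷ (↭-trans (↭-sym (++⁺ʳ ys q)) p))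
                       (∉xs ∘ ∈-resp-↭ (↭-sym q) ∘ there)
...     | k , m , s , pl , pr = k , suc m , B∷ s , ↭-trans q (prep v pl) , pr
split-surjective (v ∷ w ∷ ws) xs ys p ∉xs | inj₂ v∈ys with ∈⇒↭ v∈ys
...   | ys′ , q with split-surjective (w ∷ ws) xs ys′
                       (drop-∷ (↭-trans (↭-sym (↭-trans (++⁺ˡ xs q) (Perm.shift v xs ys′))) p)) ∉xs
...     | k , m , s , pl , pr = suc k , m , A∷ s , pl , ↭-trans q (prep v pr)

-- Realization

-- The initial x₀ is already one vertex, whereas y₀ is the empty tree. With this convention `toX`
-- keeps the number of vertices.
size : Kind → ℕ → ℕ
size xK n = suc n
size yK n = n

realize : ∀ {κ n} → Term κ n → Vec ℕ (size κ n) → BTree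
realize xleaf       (v ∷ []) = node empty v empty
realize yleaf       []       = empty
realize (toX t)     vs       = realize t vs
realize (bin s r l) (v ∷ vs) = node (realize l (splitL s vs)) v (realize r (splitR s vs))

labels-realize : ∀ {κ n} (t : Term κ n) vs → labels (realize t vs) ↭ toList vs
labels-realize xleaf       (v ∷ []) = ↭-refl
labels-realize yleaf       []       = ↭-refl
labels-realize (toX t)     vs       = labels-realize t vs
labels-realize (bin s r l) (v ∷ vs) = prep v (↭-trans
  (++⁺ (labels-realize l (splitL s vs)) (labels-realize r (splitR s vs))) (split-↭ s vs))

isEmpty-realize : ∀ {n} (t : Term xK n) vs → isEmpty (realize t vs) ≡ false
isEmpty-realize xleaf       (v ∷ []) = refl
isEmpty-realize (bin s r l) (v ∷ vs) = refl

node-injective : ∀ {l v r l′ v′ r′} → node l v r ≡ node l′ v′ r′ → l ≡ l′ × r ≡ r′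
node-injective refl = refl , refl

realize-injective : ∀ {κ n} (t t′ : Term κ n) vs → Sorted vs → realize t vs ≡ realize t′ vs → t ≡ t′
realize-injective xleaf       xleaf          _        _        _  = refl
realize-injective yleaf       yleaf          _        _        _  = refl
realize-injective (toX t)     (toX t′)       vs       ps       eq = cong toX (realize-injective t t′ vs ps eq)
realize-injective (bin s r l) (bin s′ r′ l′) (v ∷ vs) (_ ∷ ps) eq
  with node-injective eq
... | eql , eqr
  with splitL-injective s s′ vs ps
         (↭-trans (↭-sym (labels-realize l (splitL s vs)))
           (↭-trans (↭-reflexive (cong labels eql)) (labels-realize l′ (splitL s′ vs))))
... | refl = cong₂ (bin s) (realize-injective r r′ _ (Sorted-splitR s vs ps) eqr)
                           (realize-injective l l′ _ (Sorted-splitL s vs ps) eql)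

maxLabel-upper : ∀ t → All (_≤ maxLabel t) (labels t)
maxLabel-upper empty        = []
maxLabel-upper (node l v r) =
  ≤-trans (m≤m⊔n v (maxLabel l)) (m≤m⊔n _ (maxLabel r))
  ∷ Allₚ.++⁺ (All.map (λ p → ≤-trans p (≤-trans (m≤n⊔m v (maxLabel l)) (m≤m⊔n _ (maxLabel r))))
                      (maxLabel-upper l))
             (All.map (λ p → ≤-trans p (m≤n⊔m (v ⊔ maxLabel l) (maxLabel r))) (maxLabel-upper r))

maxLabel-least : ∀ t {M} → All (_≤ M) (labels t) → maxLabel t ≤ M
maxLabel-least empty        _        = z≤n
maxLabel-least (node l v r) (p ∷ ps) =
  ⊔-lub (⊔-lub p (maxLabel-least l (Allₚ.++⁻ˡ _ ps))) (maxLabel-least r (Allₚ.++⁻ʳ (labels l) ps))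

maxLabel-< : ∀ t {M} → 0 < M → All (_< M) (labels t) → maxLabel t < M
maxLabel-< t {suc M} _ ps = s≤s (maxLabel-least t (All.map (λ { (s≤s p) → p }) ps))

rootAbove-true : ∀ {v} t → All (v <_) (labels t) → rootAbove v t ≡ true
rootAbove-true empty        _       = refl
rootAbove-true (node _ _ _) (p ∷ _) = <ᵇ-true p

All-labels-realize : ∀ {P : ℕ → Set} {κ n} (t : Term κ n) vs → All P (toList vs) → All P (labels (realize t vs))
All-labels-realize t vs = All-resp-↭ (↭-sym (labels-realize t vs))

increasing-realize : ∀ {κ n} (t : Term κ n) vs → Sorted vs → increasing (realize t vs) ≡ true
increasing-realize xleaf       (v ∷ []) _        = refl
increasing-realize yleaf       []       _        = refl
increasing-realize (toX t)     vs       ps       = increasing-realize t vs ps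
increasing-realize (bin s r l) (v ∷ vs) (p ∷ ps)
  rewrite rootAbove-true (realize l (splitL s vs)) (All-labels-realize l _ (All-splitL s vs p))
        | rootAbove-true (realize r (splitR s vs)) (All-labels-realize r _ (All-splitR s vs p))
        | increasing-realize l (splitL s vs) (Sorted-splitL s vs ps)
        = increasing-realize r (splitR s vs) (Sorted-splitR s vs ps)

∨-trueʳ : ∀ b {c} → c ≡ true → b ∨ c ≡ true
∨-trueʳ true  _ = refl
∨-trueʳ false e = e

-- Positivity of the labels takes care of an empty left subtree, whose maximum is 0 by convention.
maxLabel-split : ∀ {n k m} (s : Shuffle n k m) (r : Term xK k) (l : Term yK m) vs →
  All (0 <_) (toList vs) → Sorted vs →
  maxLabel (realize l (splitL s vs)) < maxLabel (realize r (splitR s vs))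
maxLabel-split s r l vs 0< ps with split-max s vs ps
... | M , M∈ , <M = <-≤-trans
  (maxLabel-< (realize l (splitL s vs)) (All.lookup (All-splitR s vs 0<) M∈)
              (All-labels-realize l (splitL s vs) <M))
  (All.lookup (maxLabel-upper (realize r (splitR s vs)))
              (∈-resp-↭ (↭-sym (labels-realize r (splitR s vs))) M∈))

andreCond-realize : ∀ {κ n} (t : Term κ n) vs → Sorted vs → andreCond (realize t vs) ≡ true
andreCond-realize xleaf       (v ∷ []) _        = refl
andreCond-realize yleaf       []       _        = refl
andreCond-realize (toX t)     vs       ps       = andreCond-realize t vs ps
andreCond-realize (bin s r l) (v ∷ vs) (p ∷ ps)
  -- The remaining labels exceed the root label `v` and are therefore positive.
  rewrite ∨-trueʳ (isEmpty (realize l (splitL s vs)) ∧ isEmpty (realize r (splitR s vs)))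
            (<ᵇ-true (maxLabel-split s r l vs (All.map (≤-<-trans z≤n) p) ps))
        | andreCond-realize l (splitL s vs) (Sorted-splitL s vs ps)
        = andreCond-realize r (splitR s vs) (Sorted-splitR s vs ps)

∧-true⁻¹ : ∀ a {b} → a ∧ b ≡ true → a ≡ true × b ≡ true
∧-true⁻¹ true e = refl , e

increasing-node : ∀ l v r → increasing (node l v r) ≡ true →
  rootAbove v l ≡ true × rootAbove v r ≡ true × increasing l ≡ true × increasing r ≡ true
increasing-node l v r e with ∧-true⁻¹ (rootAbove v l) e
... | vl , e₁ with ∧-true⁻¹ (rootAbove v r) e₁
... | vr , e₂ with ∧-true⁻¹ (increasing l) e₂
... | il , ir = vl , vr , il , ir

andreCond-node : ∀ l v r → andreCond (node l v r) ≡ true →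
  ((isEmpty l ∧ isEmpty r) ∨ (maxLabel l <ᵇ maxLabel r)) ≡ true × andreCond l ≡ true × andreCond r ≡ true
andreCond-node l v r e with ∧-true⁻¹ ((isEmpty l ∧ isEmpty r) ∨ (maxLabel l <ᵇ maxLabel r)) e
... | m , e₁ = m , ∧-true⁻¹ (andreCond l) e₁

rootAbove⇒All : ∀ {v} t → rootAbove v t ≡ true → increasing t ≡ true → All (v <_) (labels t)
rootAbove⇒All empty        _  _   = []
rootAbove⇒All (node l w r) ab inc with increasing-node l w r inc
... | wl , wr , il , ir = v<w ∷ All.map (<-trans v<w) (Allₚ.++⁺ (rootAbove⇒All l wl il) (rootAbove⇒All r wr ir))
  where v<w = <ᵇ-true⁻¹ ab

root-minimal : ∀ l v r → increasing (node l v r) ≡ true → All (v <_) (labels l ++ labels r)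
root-minimal l v r inc with increasing-node l v r inc
... | vl , vr , il , ir = Allₚ.++⁺ (rootAbove⇒All l vl il) (rootAbove⇒All r vr ir)

minimum-unique : ∀ {v w xs ys} → All (v <_) xs → All (w <_) ys → v ∷ xs ↭ w ∷ ys → v ≡ w
minimum-unique v< w< p with ∈-resp-↭ p (here refl) | ∈-resp-↭ (↭-sym p) (here refl)
... | here e    | _         = e
... | _         | here e    = sym e
... | there v∈  | there w∈  = ⊥-elim (<-asym (All.lookup v< w∈) (All.lookup w< v∈))

sorted-last : ∀ {n} (vs : Vec ℕ (suc n)) → Sorted vs → All (_≤ last vs) (toList vs)
sorted-last (v ∷ [])     _        = ≤-refl ∷ []
sorted-last (v ∷ w ∷ ws) ((p ∷ _) ∷ ps) with sorted-last (w ∷ ws) ps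
... | q ∷ qs = ≤-trans (<⇒≤ p) q ∷ q ∷ qs

-- With the largest label on the left, the maximum of the left subtree would be at least that of the
-- right one.
andre⇒last∉ : ∀ l r {n} (vs : Vec ℕ (suc n)) → labels l ++ labels r ↭ toList vs → Sorted vs →
  ((isEmpty l ∧ isEmpty r) ∨ (maxLabel l <ᵇ maxLabel r)) ≡ true → last vs ∉ labels l
andre⇒last∉ empty          r vs       p ps an ()
andre⇒last∉ l@(node _ _ _) r vs p ps an ∈l = <⇒≱ (<ᵇ-true⁻¹ an) (≤-trans
  (maxLabel-least r (Allₚ.++⁻ʳ (labels l) (All-resp-↭ (↭-sym p) (sorted-last vs ps))))
  (All.lookup (maxLabel-upper l) ∈l))

-- Terms of kind `yK` include the empty tree, so a single recursion serves both subtrees.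
realize-surjective : ∀ t {n} (vs : Vec ℕ n) → Sorted vs → labels t ↭ toList vs →
  increasing t ≡ true → andreCond t ≡ true → Σ (Term yK n) λ τ → realize τ vs ≡ t
realize-surjective empty []       _ _ _ _ = yleaf , refl
realize-surjective empty (v ∷ vs) _ p _ _ = ⊥-elim (¬x∷xs↭[] (↭-sym p))
realize-surjective (node l v r) [] _ p _ _ = ⊥-elim (¬x∷xs↭[] p)
realize-surjective (node l v r) (w ∷ vs) (w< ∷ ps) p inc an
  with minimum-unique (root-minimal l v r inc) w< p
realize-surjective (node empty v empty) (v ∷ []) _ p inc an | refl = toX xleaf , refl
realize-surjective (node empty v (node _ _ _)) (v ∷ []) _ p inc an | refl = ⊥-elim (¬x∷xs↭[] (drop-∷ p))
realize-surjective (node (node _ _ _) v r) (v ∷ []) _ p inc an | refl = ⊥-elim (¬x∷xs↭[] (drop-∷ p))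
realize-surjective (node l v r) (v ∷ vs@(_ ∷ _)) (v< ∷ ps) p inc an | refl
  with increasing-node l v r inc | andreCond-node l v r an
... | _ , _ , il , ir | m< , al , ar
  with split-surjective vs (labels l) (labels r) (drop-∷ p) (andre⇒last∉ l r vs (drop-∷ p) ps m<)
... | k , m , s , pl , pr
  with realize-surjective l (splitL s vs) (Sorted-splitL s vs ps) pl il al
     | realize-surjective r (splitR s vs) (Sorted-splitR s vs ps) pr ir ar
... | τl , el | toX τr , er = toX (bin s τr τl) , cong₂ (λ l r → node l v r) el er

-- Leaves and unary vertices

letters : ∀ {κ n} → Kind → Term κ n → ℕ
letters xK xleaf       = 1
letters yK xleaf       = 0
letters xK yleaf       = 0
letters yK yleaf       = 1
letters κ  (toX t)     = letters κ t
letters κ  (bin s r l) = letters κ r + letters κ l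

unit : Kind → Letter → ℤ
unit xK (mkL xK _ false) = ℤ.+ 1
unit xK (mkL xK _ true)  = ℤ.-1ℤ
unit xK (mkL yK _ _)     = ℤ.+ 0
unit yK (mkL yK _ false) = ℤ.+ 1
unit yK (mkL yK _ true)  = ℤ.-1ℤ
unit yK (mkL xK _ _)     = ℤ.+ 0

unit-up : ∀ κ a → unit κ (up a) ≡ unit κ a
unit-up xK (mkL xK _ false) = refl
unit-up xK (mkL xK _ true)  = refl
unit-up xK (mkL yK _ _)     = refl
unit-up yK (mkL yK _ false) = refl
unit-up yK (mkL yK _ true)  = refl
unit-up yK (mkL xK _ _)     = refl

module _ {c ℓ : Level} (K : CommutativeRing c ℓ) where

  expo-∷ : ∀ κ a w → expo K κ (a ∷ w) ≡ unit κ a ℤ.+ expo K κ w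
  expo-∷ xK (mkL xK _ false) w = ℤₚ.+-comm (expo K xK w) _
  expo-∷ xK (mkL xK _ true)  w = ℤₚ.+-comm (expo K xK w) _
  expo-∷ xK (mkL yK _ _)     w = sym (ℤₚ.+-identityˡ _)
  expo-∷ yK (mkL yK _ false) w = ℤₚ.+-comm (expo K yK w) _
  expo-∷ yK (mkL yK _ true)  w = ℤₚ.+-comm (expo K yK w) _
  expo-∷ yK (mkL xK _ _)     w = sym (ℤₚ.+-identityˡ _)

  expo-++ : ∀ κ u w → expo K κ (u ++ w) ≡ expo K κ u ℤ.+ expo K κ w
  expo-++ κ []      w = sym (ℤₚ.+-identityˡ _)
  expo-++ κ (a ∷ u) w = begin
    expo K κ (a ∷ u ++ w)                       ≡⟨ expo-∷ κ a (u ++ w) ⟩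
    unit κ a ℤ.+ expo K κ (u ++ w)                ≡⟨ cong (λ z → unit κ a ℤ.+ z) (expo-++ κ u w) ⟩
    unit κ a ℤ.+ (expo K κ u ℤ.+ expo K κ w)      ≡⟨ ℤₚ.+-assoc (unit κ a) _ _ ⟨
    (unit κ a ℤ.+ expo K κ u) ℤ.+ expo K κ w      ≡⟨ cong (λ z → z ℤ.+ expo K κ w) (expo-∷ κ a u) ⟨
    expo K κ (a ∷ u) ℤ.+ expo K κ w ∎
    where open ≡-Reasoning

  expo-shift : ∀ κ w → expo K κ (shift w) ≡ expo K κ w
  expo-shift κ []      = refl
  expo-shift κ (a ∷ w) = trans (expo-∷ κ (up a) (shift w))
    (trans (cong₂ ℤ._+_ (unit-up κ a) (expo-shift κ w)) (sym (expo-∷ κ a w)))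

  expo-shiftBy : ∀ κ k w → expo K κ (shiftBy k w) ≡ expo K κ w
  expo-shiftBy κ zero    w = refl
  expo-shiftBy κ (suc k) w = trans (expo-shift κ (shiftBy k w)) (expo-shiftBy κ k w)

  expo-word : ∀ κ {κ′ n} (t : Term κ′ n) → expo K κ (word t) ≡ ℤ.+ letters κ t
  expo-word xK xleaf   = refl
  expo-word yK xleaf   = refl
  expo-word xK yleaf   = refl
  expo-word yK yleaf   = refl
  expo-word xK (toX t) = expo-word xK t
  expo-word yK (toX t) = expo-word yK t
  expo-word xK (bin {k = k} s r l) = trans (expo-++ xK (word r) _)
    (cong₂ ℤ._+_ (expo-word xK r) (trans (expo-shiftBy xK (suc k) (word l)) (expo-word xK l)))
  expo-word yK (bin {k = k} s r l) = trans (expo-++ yK (word r) _)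
    (cong₂ ℤ._+_ (expo-word yK r) (trans (expo-shiftBy yK (suc k) (word l)) (expo-word yK l)))

leaves-node : ∀ l v r → isEmpty r ≡ false → leaves (node l v r) ≡ leaves l + leaves r
leaves-node empty        v (node _ _ _) _ = refl
leaves-node (node _ _ _) v (node _ _ _) _ = refl

leaves-realize : ∀ {κ n} (t : Term κ n) vs → leaves (realize t vs) ≡ letters xK t
leaves-realize xleaf       (v ∷ []) = refl
leaves-realize yleaf       []       = refl
leaves-realize (toX t)     vs       = leaves-realize t vs
leaves-realize (bin s r l) (v ∷ vs) = begin
  leaves (node L v R′)         ≡⟨ leaves-node L v R′ (isEmpty-realize r (splitR s vs)) ⟩
  leaves L + leaves R′         ≡⟨ cong₂ _+_ (leaves-realize l (splitL s vs)) (leaves-realize r (splitR s vs)) ⟩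
  letters xK l + letters xK r  ≡⟨ +-comm (letters xK l) _ ⟩
  letters xK r + letters xK l  ∎
  where
  open ≡-Reasoning
  L = realize l (splitL s vs)
  R′ = realize r (splitR s vs)

emptyCount : BTree → ℕ
emptyCount t = if isEmpty t then 1 else 0

unary-node : ∀ l v r → isEmpty r ≡ false →
  unary (node l v r) ≡ (emptyCount r + unary r) + (emptyCount l + unary l)
unary-node empty        v r@(node _ _ _) _ = sym (+-comm (unary r) 1)
unary-node l@(node _ _ _) v r@(node _ _ _) _ = +-comm (unary l) (unary r)

-- A term of Dᵐ(y₀) still equal to y₀ stands for a missing left child: its letter y marks the parent
-- as unary, hence the correction by emptyCount.
unary-realize : ∀ {κ n} (t : Term κ n) vs → emptyCount (realize t vs) + unary (realize t vs) ≡ letters yK t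
unary-realize xleaf       (v ∷ []) = refl
unary-realize yleaf       []       = refl
unary-realize (toX t)     vs       = unary-realize t vs
unary-realize (bin s r l) (v ∷ vs) = trans
  (unary-node (realize l (splitL s vs)) v (realize r (splitR s vs)) (isEmpty-realize r (splitR s vs)))
  (cong₂ _+_ (unary-realize r (splitR s vs)) (unary-realize l (splitL s vs)))

-- Inversions

sumOf : (ℕ → ℕ) → List ℕ → ℕ
sumOf f = foldr (λ x acc → f x + acc) 0

sumOf-++ : ∀ f xs ys → sumOf f (xs ++ ys) ≡ sumOf f xs + sumOf f ys
sumOf-++ f []       ys = refl
sumOf-++ f (x ∷ xs) ys = trans (cong (f x +_) (sumOf-++ f xs ys)) (sym (+-assoc (f x) _ _))

sumOf-cong : ∀ {f g xs} → All (λ x → f x ≡ g x) xs → sumOf f xs ≡ sumOf g xs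
sumOf-cong []       = refl
sumOf-cong (e ∷ es) = cong₂ _+_ e (sumOf-cong es)

sumOf-+ : ∀ f g xs → sumOf (λ x → f x + g x) xs ≡ sumOf f xs + sumOf g xs
sumOf-+ f g []       = refl
sumOf-+ f g (x ∷ xs) = trans (cong (f x + g x +_) (sumOf-+ f g xs))
  (solve 4 (λ a b c d → a :+ b :+ (c :+ d) := a :+ c :+ (b :+ d)) refl (f x) (g x) (sumOf f xs) (sumOf g xs))
  where open +-*-Solver

sumOf-↭ : ∀ f {xs ys} → xs ↭ ys → sumOf f xs ≡ sumOf f ys
sumOf-↭ f _↭_.refl        = refl
sumOf-↭ f (prep x p)      = cong (f x +_) (sumOf-↭ f p)
sumOf-↭ f (_↭_.swap {xs} {ys} x y p)  = trans (cong (λ z → f x + (f y + z)) (sumOf-↭ f p))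
  (solve 3 (λ a b c → a :+ (b :+ c) := b :+ (a :+ c)) refl (f x) (f y) (sumOf f ys))
  where open +-*-Solver
sumOf-↭ f (_↭_.trans p q) = trans (sumOf-↭ f p) (sumOf-↭ f q)

count-sumOf : ∀ p xs → count p xs ≡ sumOf (λ x → if p x then 1 else 0) xs
count-sumOf p []       = refl
count-sumOf p (x ∷ xs) = cong (_ +_) (count-sumOf p xs)

count-++ : ∀ p (xs ys : List ℕ) → count p (xs ++ ys) ≡ count p xs + count p ys
count-++ p []       ys = refl
count-++ p (x ∷ xs) ys = trans (cong ((if p x then 1 else 0) +_) (count-++ p xs ys))
                               (sym (+-assoc (if p x then 1 else 0) _ _))

count-cong : ∀ {p q : ℕ → Bool} {xs} → All (λ x → p x ≡ q x) xs → count p xs ≡ count q xs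
count-cong []       = refl
count-cong (e ∷ es) = cong₂ _+_ (cong (λ b → if b then 1 else 0) e) (count-cong es)

count-false : ∀ {p : ℕ → Bool} {xs} → All (λ x → p x ≡ false) xs → count p xs ≡ 0
count-false []                   = refl
count-false (e ∷ es) rewrite e = count-false es

cross : List ℕ → List ℕ → ℕ
cross xs ys = sumOf (λ i → count (_<ᵇ i) ys) xs

cross-↭ : ∀ {xs xs′ ys ys′} → xs ↭ xs′ → ys ↭ ys′ → cross xs ys ≡ cross xs′ ys′
cross-↭ {xs} {xs′} {ys} {ys′} p q = trans (sumOf-↭ _ p) (sumOf-cong (All.universal count-↭ xs′))
  where
  count-↭ : ∀ i → count (_<ᵇ i) ys ≡ count (_<ᵇ i) ys′
  count-↭ i = trans (count-sumOf _ ys) (trans (sumOf-↭ _ q) (sym (count-sumOf _ ys′)))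

length-toList : ∀ {n} (vs : Vec ℕ n) → length (toList vs) ≡ n
length-toList []       = refl
length-toList (v ∷ vs) = cong suc (length-toList vs)

sumOf-1 : ∀ xs → sumOf (λ _ → 1) xs ≡ length xs
sumOf-1 []       = refl
sumOf-1 (x ∷ xs) = cong suc (sumOf-1 xs)

-- A smaller label on the right and a larger one on the left amount to an A with a later B. The last
-- label, on the right without a letter, is too large to take part.
cross-split : ∀ {n k m} (s : Shuffle n k m) vs → Sorted vs →
  cross (toList (splitL s vs)) (toList (splitR s vs)) ≡ invs s
cross-split []     vs       _        = refl
cross-split (A∷_ {m = m} s) (v ∷ vs) (p ∷ ps) = begin
  cross Ls (v ∷ Rs)
    ≡⟨ sumOf-cong (All.map (λ {i} v<i → cong (λ b → (if b then 1 else 0) + count (_<ᵇ i) Rs) (<ᵇ-true v<i))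
                           (All-splitL s vs p)) ⟩
  sumOf (λ i → 1 + count (_<ᵇ i) Rs) Ls
    ≡⟨ sumOf-+ (λ _ → 1) _ Ls ⟩
  sumOf (λ _ → 1) Ls + cross Ls Rs
    ≡⟨ cong₂ _+_ (trans (sumOf-1 Ls) (length-toList (splitL s vs))) (cross-split s vs ps) ⟩
  m + invs s ∎
  where
  open ≡-Reasoning
  Ls = toList (splitL s vs)
  Rs = toList (splitR s vs)
cross-split (B∷ s) (v ∷ vs) (p ∷ ps) = cong₂ _+_
  (count-false (All.map (<ᵇ-false ∘ <⇒≤) (All-splitR s vs p))) (cross-split s vs ps)

subtreeAt-root : ∀ l v r → subtreeAt (node l v r) v ≡ just (node l v r)
subtreeAt-root l v r rewrite ≡ᵇ-refl v = refl

subtreeAt-left : ∀ l {v} r {u s} → v ≢ u → subtreeAt l u ≡ just s → subtreeAt (node l v r) u ≡ just s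
subtreeAt-left l r v≢u e rewrite ≡ᵇ-false v≢u | e = refl

subtreeAt-right : ∀ l {v} r {u} → v ≢ u → subtreeAt l u ≡ nothing → subtreeAt (node l v r) u ≡ subtreeAt r u
subtreeAt-right l r v≢u e rewrite ≡ᵇ-false v≢u | e = refl

subtreeAt-∉ : ∀ t {u} → u ∉ labels t → subtreeAt t u ≡ nothing
subtreeAt-∉ empty        _  = refl
subtreeAt-∉ (node l v r) u∉ = trans
  (subtreeAt-right l r (u∉ ∘ here ∘ sym) (subtreeAt-∉ l (u∉ ∘ there ∘ ∈-++⁺ˡ)))
  (subtreeAt-∉ r (u∉ ∘ there ∘ ∈-++⁺ʳ (labels l)))

subtreeAt-∈ : ∀ t {u} → u ∈ labels t → ∃ λ s → subtreeAt t u ≡ just s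
subtreeAt-∈ (node l v r) {u} u∈ with v ≡ᵇ u in v≡ᵇu
... | true  = _ , refl
... | false with subtreeAt l u in eq
...   | just s  = s , refl
...   | nothing with u∈
...     | here refl with () ← trans (sym v≡ᵇu) (≡ᵇ-refl v)
...     | there u∈′ with ∈-++⁻ (labels l) u∈′
...       | inj₂ u∈r = subtreeAt-∈ r u∈r
...       | inj₁ u∈l with subtreeAt-∈ l u∈l
...         | s , eq′ with () ← trans (sym eq) eq′

subtreeAt-⊆ : ∀ t {u s} → subtreeAt t u ≡ just s → ∀ {x} → x ∈ labels s → x ∈ labels t
subtreeAt-⊆ (node l v r) {u} eq x∈ with v ≡ᵇ u
subtreeAt-⊆ (node l v r) {u} refl x∈ | true = x∈
... | false with subtreeAt l u in eql
subtreeAt-⊆ (node l v r) {u} refl x∈ | false | just s = there (∈-++⁺ˡ (subtreeAt-⊆ l eql x∈))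
... | nothing = there (∈-++⁺ʳ (labels l) (subtreeAt-⊆ r eq x∈))

path-⊆ : ∀ t i {x} → x ∈ path t i → x ∈ labels t
path-⊆ (node l v r) i x∈ with v ≡ᵇ i
path-⊆ (node l v r) i (here e) | true = here e
... | false with elem i (labels l)
path-⊆ (node l v r) i (here e)   | false | true = here e
path-⊆ (node l v r) i (there x∈) | false | true = there (∈-++⁺ˡ (path-⊆ l i x∈))
... | false with elem i (labels r)
path-⊆ (node l v r) i (here e)   | false | false | true = here e
path-⊆ (node l v r) i (there x∈) | false | false | true = there (∈-++⁺ʳ (labels l) (path-⊆ r i x∈))

path-left : ∀ l {v} r {i} → v ≢ i → i ∈ labels l → path (node l v r) i ≡ v ∷ path l i
path-left l r v≢i i∈ rewrite ≡ᵇ-false v≢i | elem-true i∈ = refl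

path-right : ∀ l {v} r {i} → v ≢ i → i ∉ labels l → i ∈ labels r → path (node l v r) i ≡ v ∷ path r i
path-right l r v≢i i∉ i∈ rewrite ≡ᵇ-false v≢i | elem-false (labels l) i∉ | elem-true i∈ = refl

root∈path : ∀ l v r {i} → i ∈ labels (node l v r) → v ∈ path (node l v r) i
root∈path l v r {i} i∈ with v ≡ᵇ i in v≡ᵇi
... | true  = here refl
... | false with elem i (labels l) in el
...   | true  = here refl
...   | false with elem i (labels r) in er
...     | true  = here refl
...     | false with i∈
...       | here refl with () ← trans (sym v≡ᵇi) (≡ᵇ-refl v)
...       | there i∈′ with ∈-++⁻ (labels l) i∈′
...         | inj₁ i∈l with () ← trans (sym el) (elem-true i∈l)
...         | inj₂ i∈r with () ← trans (sym er) (elem-true i∈r)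

inLeft inRight : Maybe BTree → ℕ → Bool
inLeft (just (node l _ _)) i = elem i (labels l)
inLeft _                   i = false
inRight (just (node _ _ r)) j = elem j (labels r)
inRight _                   j = false

leftRoot : Maybe BTree → Maybe ℕ
leftRoot (just (node (node _ c _) _ _)) = just c
leftRoot _                              = nothing

onPath : List ℕ → Maybe ℕ → Bool
onPath p (just c) = elem c p
onPath p nothing  = false

-- invPair with the tree entering only through the path to i and the subtree lookup, so that it can
-- be compared between a tree and its subtrees.
invAt : List ℕ → (ℕ → Maybe BTree) → ℕ → ℕ → Bool
invAt p S i j = (j <ᵇ i) ∧
  ((not (elem j p) ∧ any (λ u → inLeft (S u) i ∧ inRight (S u) j) p) ∨ (elem j p ∧ onPath p (leftRoot (S j))))

inLeftSubtreeOf-inLeft : ∀ t v i → inLeftSubtreeOf t v i ≡ inLeft (subtreeAt t v) i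
inLeftSubtreeOf-inLeft t v i with subtreeAt t v
... | nothing           = refl
... | just empty        = refl
... | just (node _ _ _) = refl

inRightSubtreeOf-inRight : ∀ t v j → inRightSubtreeOf t v j ≡ inRight (subtreeAt t v) j
inRightSubtreeOf-inRight t v j with subtreeAt t v
... | nothing           = refl
... | just empty        = refl
... | just (node _ _ _) = refl

leftChild-leftRoot : ∀ t v → leftChild t v ≡ leftRoot (subtreeAt t v)
leftChild-leftRoot t v with subtreeAt t v
... | nothing                        = refl
... | just empty                     = refl
... | just (node empty _ _)          = refl
... | just (node (node _ _ _) _ _)   = refl

invPair-invAt : ∀ t i j → invPair t i j ≡ invAt (path t i) (subtreeAt t) i j
invPair-invAt t i j
  rewrite any-cong {f = λ v → inLeftSubtreeOf t v i ∧ inRightSubtreeOf t v j}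
                   {g = λ v → inLeft (subtreeAt t v) i ∧ inRight (subtreeAt t v) j}
            (All.universal (λ v → cong₂ _∧_ (inLeftSubtreeOf-inLeft t v i) (inRightSubtreeOf-inRight t v j))
                           (path t i))
        | sym (leftChild-leftRoot t j)
  -- `invPair` carries its own local copy of `onPath`; the two agree by computation once the left
  -- child is known.
  with leftChild t j
... | just c  = refl
... | nothing = refl

leftRoot-∈ : ∀ t j {c} → leftRoot (subtreeAt t j) ≡ just c → c ∈ labels t
leftRoot-∈ t j eq with subtreeAt t j in e
leftRoot-∈ t j refl | just (node (node _ c _) _ _) = subtreeAt-⊆ t e (there (here refl))

elem-∷-≢ : ∀ {j v} p → j ≢ v → elem j (v ∷ p) ≡ elem j p
elem-∷-≢ p j≢v rewrite ≡ᵇ-false j≢v = refl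

-- The two paths differ only by `v`, which does not separate `i` from `j` and is neither `j` nor the
-- left child of `j`.
invPair-child : ∀ t s {v i j} → path t i ≡ v ∷ path s i →
  (∀ {u} → u ∈ labels s → subtreeAt t u ≡ subtreeAt s u) → v ∉ labels s →
  inLeft (subtreeAt t v) i ∧ inRight (subtreeAt t v) j ≡ false → j ∈ labels s →
  invPair t i j ≡ invPair s i j
invPair-child t s {v} {i} {j} ep es v∉ ev j∈ = begin
  invPair t i j
    ≡⟨ invPair-invAt t i j ⟩
  invAt (path t i) (subtreeAt t) i j
    ≡⟨ cong (λ p → invAt p (subtreeAt t) i j) ep ⟩
  invAt (v ∷ path s i) (subtreeAt t) i j
    ≡⟨ cong ((j <ᵇ i) ∧_) (cong₂ _∨_ (cong₂ (λ a b → not a ∧ b) ej ea) (cong₂ _∧_ ej eo)) ⟩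
  invAt (path s i) (subtreeAt s) i j
    ≡⟨ invPair-invAt s i j ⟨
  invPair s i j ∎
  where
  open ≡-Reasoning
  ≢v : ∀ {u} → u ∈ labels s → u ≢ v
  ≢v u∈ refl = v∉ u∈
  ej : elem j (v ∷ path s i) ≡ elem j (path s i)
  ej = elem-∷-≢ (path s i) (≢v j∈)
  ea : any (λ u → inLeft (subtreeAt t u) i ∧ inRight (subtreeAt t u) j) (v ∷ path s i)
       ≡ any (λ u → inLeft (subtreeAt s u) i ∧ inRight (subtreeAt s u) j) (path s i)
  ea = cong₂ _∨_ ev (any-cong (All.tabulate λ u∈ →
         cong (λ m → inLeft m i ∧ inRight m j) (es (path-⊆ s i u∈))))
  eo : onPath (v ∷ path s i) (leftRoot (subtreeAt t j)) ≡ onPath (path s i) (leftRoot (subtreeAt s j))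
  eo rewrite es j∈ with leftRoot (subtreeAt s j) in e
  ... | nothing = refl
  ... | just c  = elem-∷-≢ (path s i) (≢v (leftRoot-∈ s j e))

inRight-∉ : ∀ t u {j} → j ∉ labels t → inRight (subtreeAt t u) j ≡ false
inRight-∉ t u j∉ with subtreeAt t u in e
... | nothing           = refl
... | just empty        = refl
... | just (node l v r) = elem-false (labels r) (j∉ ∘ subtreeAt-⊆ t e ∘ there ∘ ∈-++⁺ʳ (labels l))

invPair-≤ : ∀ t {i j} → i ≤ j → invPair t i j ≡ false
invPair-≤ t i≤j rewrite <ᵇ-false i≤j = refl

module _ (l : BTree) (v : ℕ) (r : BTree)
         (v< : All (v <_) (labels l ++ labels r)) (uniq : Unique (labels l ++ labels r)) where

  private
    t  = node l v r
    Ll = labels l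
    Lr = labels r

    v<l : ∀ {i} → i ∈ Ll → v < i
    v<l i∈ = All.lookup v< (∈-++⁺ˡ i∈)

    v<r : ∀ {i} → i ∈ Lr → v < i
    v<r i∈ = All.lookup v< (∈-++⁺ʳ Ll i∈)

    v∉l : v ∉ Ll
    v∉l v∈ = <-irrefl refl (v<l v∈)

    v∉r : v ∉ Lr
    v∉r v∈ = <-irrefl refl (v<r v∈)

    l∌r : ∀ {i} → i ∈ Lr → i ∉ Ll
    l∌r i∈r i∈l = unique-disjoint Ll uniq i∈l i∈r

    path-l : ∀ {i} → i ∈ Ll → path t i ≡ v ∷ path l i
    path-l i∈ = path-left l r (<⇒≢ (v<l i∈)) i∈

    path-r : ∀ {i} → i ∈ Lr → path t i ≡ v ∷ path r i
    path-r i∈ = path-right l r (<⇒≢ (v<r i∈)) (l∌r i∈) i∈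

    subtreeAt-l : ∀ {u} → u ∈ Ll → subtreeAt t u ≡ subtreeAt l u
    subtreeAt-l u∈ with subtreeAt-∈ l u∈
    ... | s , e = trans (subtreeAt-left l r (<⇒≢ (v<l u∈)) e) (sym e)

    subtreeAt-r : ∀ {u} → u ∈ Lr → subtreeAt t u ≡ subtreeAt r u
    subtreeAt-r u∈ = subtreeAt-right l r (<⇒≢ (v<r u∈)) (subtreeAt-∉ l (l∌r u∈))

  invPair-ll : ∀ {i j} → i ∈ Ll → j ∈ Ll → invPair t i j ≡ invPair l i j
  invPair-ll {i} {j} i∈ j∈ = invPair-child t l (path-l i∈) subtreeAt-l v∉l
    (trans (cong (λ m → inLeft m i ∧ inRight m j) (subtreeAt-root l v r))
           (trans (cong (elem i Ll ∧_) (elem-false Lr (λ j∈r → l∌r j∈r j∈))) (∧-zeroʳ _)))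
    j∈

  invPair-rr : ∀ {i j} → i ∈ Lr → j ∈ Lr → invPair t i j ≡ invPair r i j
  invPair-rr {i} {j} i∈ j∈ = invPair-child t r (path-r i∈) subtreeAt-r v∉r
    (trans (cong (λ m → inLeft m i ∧ inRight m j) (subtreeAt-root l v r))
           (cong (_∧ elem j Lr) (elem-false Ll (l∌r i∈))))
    j∈

  -- The root separates `i` from `j`, and `j` is not on the path to `i`; clause (1) holds and only
  -- the comparison is left.
  invPair-lr : ∀ {i j} → i ∈ Ll → j ∈ Lr → invPair t i j ≡ (j <ᵇ i)
  invPair-lr {i} {j} i∈ j∈
    rewrite invPair-invAt t i j | path-l i∈ | subtreeAt-root l v r
          | elem-∷-≢ (path l i) (≢-sym (<⇒≢ (v<r j∈)))
          | elem-false (path l i) (l∌r j∈ ∘ path-⊆ l i)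
          | elem-true i∈ | elem-true j∈
    = ∧-identityʳ (j <ᵇ i)

  -- No vertex of the path serves in clause (1): the root has `i` on its right, and the other
  -- vertices lie in `r`, which does not contain `j`.
  invPair-rl : ∀ {i j} → i ∈ Lr → j ∈ Ll → invPair t i j ≡ false
  invPair-rl {i} {j} i∈ j∈
    rewrite invPair-invAt t i j | path-r i∈ | subtreeAt-root l v r
          | elem-∷-≢ (path r i) (≢-sym (<⇒≢ (v<l j∈)))
          | elem-false (path r i) (λ j∈p → l∌r (path-⊆ r i j∈p) j∈)
          | elem-false Ll (l∌r i∈)
          | any-false {f = λ u → inLeft (subtreeAt t u) i ∧ inRight (subtreeAt t u) j} {xs = path r i}
              (All.tabulate λ {u} u∈ → trans
                (cong (_ ∧_) (trans (cong (λ m → inRight m j) (subtreeAt-r (path-⊆ r i u∈)))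
                                       (inRight-∉ r u (λ j∈r → l∌r j∈r j∈))))
                (∧-zeroʳ _))
    = ∧-zeroʳ (j <ᵇ i)

  -- Clause (2) applies: the path to `i` enters the left subtree through its root, the left child of
  -- `v`.
  invPair-lv : ∀ {i} → i ∈ Ll → invPair t i v ≡ true
  invPair-lv {i} i∈
    rewrite invPair-invAt t i v | path-l i∈ | subtreeAt-root l v r | ≡ᵇ-refl v | <ᵇ-true (v<l i∈)
    = onPath-left l i∈ v∉l
    where
    onPath-left : ∀ s → i ∈ labels s → v ∉ labels s →
      onPath (v ∷ path s i) (leftRoot (just (node s v r))) ≡ true
    onPath-left (node l′ c r′) i∈ v∉ =
      elem-true {xs = v ∷ path (node l′ c r′) i} (there (root∈path l′ c r′ i∈))

  -- The path to `i` turns right at `v`, so it misses the left child of `v`.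
  invPair-rv : ∀ {i} → i ∈ Lr → invPair t i v ≡ false
  invPair-rv {i} i∈
    rewrite invPair-invAt t i v | path-r i∈ | subtreeAt-root l v r | ≡ᵇ-refl v | <ᵇ-true (v<r i∈)
    = onPath-right l v∉l l∌r
    where
    onPath-right : ∀ s → v ∉ labels s → (∀ {x} → x ∈ Lr → x ∉ labels s) →
      onPath (v ∷ path r i) (leftRoot (just (node s v r))) ≡ false
    onPath-right empty          _  _    = refl
    onPath-right (node l′ c r′) v∉ disj = elem-false {c} (v ∷ path r i)
      λ { (here refl) → v∉ (here refl) ; (there c∈) → disj (path-⊆ r i c∈) (here refl) }

  inv-root : count (invPair t v) (labels t) ≡ 0
  inv-root = count-false (All.map (invPair-≤ t) (≤-refl ∷ All.map <⇒≤ v<))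

  inv-left : ∀ {i} → i ∈ Ll →
    count (invPair t i) (labels t) ≡ count (invPair l i) Ll + (count (_<ᵇ i) Lr + 1)
  inv-left {i} i∈ = begin
    (if invPair t i v then 1 else 0) + count (invPair t i) (Ll ++ Lr)
      ≡⟨ cong₂ (λ b c → (if b then 1 else 0) + c) (invPair-lv i∈)
           (trans (count-++ _ Ll Lr) (cong₂ _+_ (count-cong (All.tabulate (invPair-ll i∈)))
                                                (count-cong (All.tabulate (invPair-lr i∈))))) ⟩
    1 + (count (invPair l i) Ll + count (_<ᵇ i) Lr)
      ≡⟨ solve 2 (λ a b → con 1 :+ (a :+ b) := a :+ (b :+ con 1))
               refl (count (invPair l i) Ll) (count (_<ᵇ i) Lr) ⟩
    count (invPair l i) Ll + (count (_<ᵇ i) Lr + 1) ∎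
    where
    open ≡-Reasoning
    open +-*-Solver

  inv-right : ∀ {i} → i ∈ Lr → count (invPair t i) (labels t) ≡ count (invPair r i) Lr
  inv-right {i} i∈ = cong₂ (λ b c → (if b then 1 else 0) + c) (invPair-rv i∈)
    (trans (count-++ _ Ll Lr) (cong₂ _+_ (count-false (All.tabulate (invPair-rl i∈)))
                                         (count-cong (All.tabulate (invPair-rr i∈)))))

  -- This is the recursion defining `expQ`: the crossing inversions match `invs`, and `length Ll`,
  -- one inversion with the root for each label on the left, matches `m`.
  inv-node : inv t ≡ inv r + (inv l + (cross Ll Lr + length Ll))
  inv-node = begin
    count (invPair t v) (labels t) + sumOf f (Ll ++ Lr)
      ≡⟨ cong₂ _+_ inv-root (sumOf-++ f Ll Lr) ⟩
    sumOf f Ll + sumOf f Lr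
      ≡⟨ cong₂ _+_ (sumOf-cong (All.tabulate inv-left)) (sumOf-cong (All.tabulate inv-right)) ⟩
    sumOf (λ i → count (invPair l i) Ll + (count (_<ᵇ i) Lr + 1)) Ll + sumOf (λ i → count (invPair r i) Lr) Lr
      ≡⟨ cong₂ _+_ (trans (sumOf-+ _ _ Ll) (cong (inv l +_)
           (trans (sumOf-+ _ _ Ll) (cong (cross Ll Lr +_) (sumOf-1 Ll))))) refl ⟩
    inv l + (cross Ll Lr + length Ll) + inv r
      ≡⟨ +-comm _ (inv r) ⟩
    inv r + (inv l + (cross Ll Lr + length Ll)) ∎
    where
    open ≡-Reasoning
    f = λ i → count (invPair t i) (labels t)

inv-realize : ∀ {κ n} (t : Term κ n) vs → Sorted vs → inv (realize t vs) ≡ expQ t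
inv-realize xleaf       (v ∷ []) _ rewrite <ᵇ-false (≤-refl {v}) = refl
inv-realize yleaf       []       _        = refl
inv-realize (toX t)     vs       ps       = inv-realize t vs ps
inv-realize (bin {m = m} s r l) (v ∷ vs) (p ∷ ps) = trans
  (inv-node L v R′ (All-resp-↭ (↭-sym perm) p)
    (Unique-resp-↭ (↭-sym perm) (AllPairs.map <⇒≢ ps)))
  (cong₂ _+_ (inv-realize r _ (Sorted-splitR s vs ps)) (cong₂ _+_ (inv-realize l _ (Sorted-splitL s vs ps))
    (cong₂ _+_ (trans (cross-↭ pl pr) (cross-split s vs ps))
               (trans (↭-length pl) (length-toList (splitL s vs))))))
  where
  L = realize l (splitL s vs)
  R′ = realize r (splitR s vs)
  pl = labels-realize l (splitL s vs)
  pr = labels-realize r (splitR s vs)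
  perm = drop-∷ (labels-realize (bin s r l) (v ∷ vs))

-- Terms and André I trees on [n]

isLabellingOf⇒↭ : ∀ n t → isLabellingOf n t ≡ true → labels t ↭ applyUpTo suc n
isLabellingOf⇒↭ n t e with ∧-true⁻¹ (length (labels t) ≡ᵇ n) e
... | len , mem = ↭-sym (unique-⊆⇒↭ (AllPairsₚ.applyUpTo⁺₁ suc n λ i<j _ → <⇒≢ (s≤s i<j))
  (λ i∈ → elem-true⁻¹ (labels t) (All.lookup (all-true⁻¹ (map suc (upTo n)) mem)
                                             (subst (_ ∈_) (sym (map-upTo suc n)) i∈)))
  (trans (≡ᵇ-true⁻¹ len) (sym (length-applyUpTo suc n))))

↭⇒isLabellingOf : ∀ n t → labels t ↭ applyUpTo suc n → isLabellingOf n t ≡ true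
↭⇒isLabellingOf n t p = cong₂ _∧_
  (trans (cong (_≡ᵇ n) (trans (↭-length p) (length-applyUpTo suc n))) (≡ᵇ-refl n))
  (all-true {xs = map suc (upTo n)} (All.tabulate λ i∈ →
    elem-true (∈-resp-↭ (↭-sym p) (subst (_ ∈_) (map-upTo suc n) i∈))))

applyUpToᵛ : (ℕ → ℕ) → ∀ n → Vec ℕ n
applyUpToᵛ f zero    = []
applyUpToᵛ f (suc n) = f 0 ∷ applyUpToᵛ (f ∘ suc) n

toList-applyUpToᵛ : ∀ f n → toList (applyUpToᵛ f n) ≡ applyUpTo f n
toList-applyUpToᵛ f zero    = refl
toList-applyUpToᵛ f (suc n) = cong (f 0 ∷_) (toList-applyUpToᵛ (f ∘ suc) n)

[1⋯_] : ∀ n → Vec ℕ n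
[1⋯ n ] = applyUpToᵛ suc n

[1⋯]-sorted : ∀ n → Sorted [1⋯ n ]
[1⋯]-sorted n rewrite toList-applyUpToᵛ suc n = AllPairsₚ.applyUpTo⁺₁ suc n λ i<j _ → s≤s i<j

tree : ∀ {n} → Term xK n → BTree
tree {n} t = realize t [1⋯ suc n ]

tree-isAndreI : ∀ {n} (t : Term xK n) → isAndreI (suc n) (tree t) ≡ true
tree-isAndreI {n} t = cong₂ _∧_
  (↭⇒isLabellingOf (suc n) (tree t)
    (subst (labels (tree t) ↭_) (toList-applyUpToᵛ suc (suc n)) (labels-realize t [1⋯ suc n ])))
  (cong₂ _∧_ (increasing-realize t _ ([1⋯]-sorted (suc n)))
             (andreCond-realize t _ ([1⋯]-sorted (suc n))))

tree-injective : ∀ {n} {t u : Term xK n} → tree t ≡ tree u → t ≡ u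
tree-injective {n} {t} {u} = realize-injective t u _ ([1⋯]-sorted (suc n))

tree-surjective : ∀ {n} t → isAndreI (suc n) t ≡ true → Σ (Term xK n) λ τ → tree τ ≡ t
tree-surjective {n} t e with ∧-true⁻¹ (isLabellingOf (suc n) t) e
... | lab , e′ with ∧-true⁻¹ (increasing t) e′
... | inc , an with realize-surjective t [1⋯ suc n ] ([1⋯]-sorted (suc n))
  (subst (labels t ↭_) (sym (toList-applyUpToᵛ suc (suc n))) (isLabellingOf⇒↭ (suc n) t lab)) inc an
... | toX τ , eq = τ , eq

tree-unary : ∀ {n} (t : Term xK n) → unary (tree t) ≡ letters yK t
tree-unary {n} t = trans (cong (λ b → (if b then 1 else 0) + unary (tree t)) (sym (isEmpty-realize t [1⋯ suc n ])))
                         (unary-realize t [1⋯ suc n ])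

-- Comparing coefficients

lookup-injective : ∀ {A : Set} {xs : List A} → Unique xs → ∀ {i j} → lookup xs i ≡ lookup xs j → i ≡ j
lookup-injective (x∉ ∷ u) {zero}  {zero}  _  = refl
lookup-injective (x∉ ∷ u) {zero}  {suc j} eq = ⊥-elim (All.lookup x∉ (∈-lookup j) eq)
lookup-injective (x∉ ∷ u) {suc i} {zero}  eq = ⊥-elim (All.lookup x∉ (∈-lookup i) (sym eq))
lookup-injective (x∉ ∷ u) {suc i} {suc j} eq = cong suc (lookup-injective u eq)

-- Entries of the list and elements of `B` are compared only through their injections into `C`:
-- equal images give the two maps, and injectivity gives both inverse laws.
Fin-length-↔ : ∀ {A B C : Set} {xs : List A} (f : A → C) (g : B → C) → Unique xs →
  (∀ {x y} → f x ≡ f y → x ≡ y) → (∀ {y z} → g y ≡ g z → y ≡ z) →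
  (∀ {x} → x ∈ xs → Σ B λ y → g y ≡ f x) → (∀ y → ∃ λ x → x ∈ xs × f x ≡ g y) →
  Fin (length xs) ↔ B
Fin-length-↔ {xs = xs} f g u f-inj g-inj image preimage = mk↔ₛ′ to from to-from from-to
  where
  to = λ i → proj₁ (image (∈-lookup {xs = xs} i))
  from = λ y → index (proj₁ (proj₂ (preimage y)))
  g-to : ∀ i → g (to i) ≡ f (lookup xs i)
  g-to i = proj₂ (image (∈-lookup i))
  lookup-from : ∀ y → f (lookup xs (from y)) ≡ g y
  lookup-from y with preimage y
  ... | x , x∈ , e = trans (cong f (sym (lookup-index x∈))) e
  to-from : ∀ y → to (from y) ≡ y
  to-from y = g-inj (trans (g-to (from y)) (lookup-from y))
  from-to : ∀ i → from (to i) ≡ i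
  from-to i = lookup-injective u (f-inj (trans (lookup-from (to i)) (g-to i)))

-- All components but the tree are proofs of equations, hence unique; counting elements of the type
-- is counting trees.
AndreITreesWith-≡ : ∀ {n a b d} {s t : AndreITreesWith n a b d} → proj₁ s ≡ proj₁ t → s ≡ t
AndreITreesWith-≡ {s = t , p₁ , p₂ , p₃ , p₄} {t , q₁ , q₂ , q₃ , q₄} refl
  rewrite uip p₁ q₁ | uip p₂ q₂ | uip p₃ q₃ | uip p₄ q₄ = refl

does-true⁻¹ : ∀ {p} {P : Set p} (P? : Dec P) → does P? ≡ true → P
does-true⁻¹ (yes p) _ = p

module _ {c ℓ : Level} (K : CommutativeRing c ℓ) (a : ℕ) (b d : ℤ) where
  open CommutativeRing K using (_≈_)
    renaming (refl to ≈-refl; trans to ≈-trans; +-cong to ≈-+-cong; +-identityˡ to ≈-+-identityˡ)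

  contributes : ∀ {n} → Term xK n → Bool
  contributes t = (expQ t ≡ᵇ a) ∧ does (expo K xK (word t) ℤ.≟ b) ∧ does (expo K yK (word t) ℤ.≟ d)

  contributing : ∀ {n} → List (Term xK n) → List (Term xK n)
  contributing = filter (λ t → contributes t Bool.≟ true)

  φ-monomials : ∀ {n} (ts : List (Term xK n)) →
    φ K (map (monomial K) ts) a b d ≈ ι K (length (contributing ts))
  φ-monomials []       = ≈-refl
  φ-monomials (t ∷ ts) with contributes t
  ... | true  = ≈-+-cong ≈-refl (φ-monomials ts)
  ... | false = ≈-trans (≈-+-identityˡ _) (φ-monomials ts)

  contributes⇒stats : ∀ {n} (t : Term xK n) → contributes t ≡ true →
    inv (tree t) ≡ a × ℤ.+ leaves (tree t) ≡ b × ℤ.+ unary (tree t) ≡ d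
  contributes⇒stats {n} t e with ∧-true⁻¹ (expQ t ≡ᵇ a) e
  ... | ea , e′ with ∧-true⁻¹ (does (expo K xK (word t) ℤ.≟ b)) e′
  ... | eb , ed
    = trans (inv-realize t _ ([1⋯]-sorted (suc n))) (≡ᵇ-true⁻¹ ea)
    , trans (trans (cong ℤ.+_ (leaves-realize t _)) (sym (expo-word K xK t)))
            (does-true⁻¹ (expo K xK (word t) ℤ.≟ b) eb)
    , trans (trans (cong ℤ.+_ (tree-unary t)) (sym (expo-word K yK t)))
            (does-true⁻¹ (expo K yK (word t) ℤ.≟ d) ed)

  stats⇒contributes : ∀ {n} (t : Term xK n) →
    inv (tree t) ≡ a → ℤ.+ leaves (tree t) ≡ b → ℤ.+ unary (tree t) ≡ d → contributes t ≡ true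
  stats⇒contributes {n} t ea eb ed = cong₂ _∧_
    (trans (cong (_≡ᵇ a) (trans (sym (inv-realize t _ ([1⋯]-sorted (suc n)))) ea)) (≡ᵇ-refl a))
    (cong₂ _∧_
      (dec-true (expo K xK (word t) ℤ.≟ b)
        (trans (expo-word K xK t) (trans (cong ℤ.+_ (sym (leaves-realize t _))) eb)))
      (dec-true (expo K yK (word t) ℤ.≟ d)
        (trans (expo-word K yK t) (trans (cong ℤ.+_ (sym (tree-unary t))) ed))))

  contributing↔trees : ∀ n → Fin (length (contributing (terms n))) ↔ AndreITreesWith (suc n) a b d
  contributing↔trees n = Fin-length-↔ tree proj₁ (Uniqueₚ.filter⁺ _ (terms-unique n))
    tree-injective AndreITreesWith-≡ to from
    where
    to : ∀ {t} → t ∈ contributing (terms n) → Σ (AndreITreesWith (suc n) a b d) λ s → proj₁ s ≡ tree t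
    to {t} t∈ = (tree t , tree-isAndreI t ,
      contributes⇒stats t (proj₂ (∈-filter⁻ (λ t → contributes t Bool.≟ true) {xs = terms n} t∈))) , refl

    from : ∀ s → ∃ λ t → t ∈ contributing (terms n) × tree t ≡ proj₁ s
    from (u , an , ea , eb , ed) with tree-surjective {n} u an
    ... | t , refl = t , ∈-filter⁺ (λ t → contributes t Bool.≟ true) (terms-complete t)
                           (stats⇒contributes t ea eb ed) , refl

theorem6p5 : {c ℓ : Level} (K : CommutativeRing c ℓ) → CharacteristicZero K →
    (n : ℕ) → (a : ℕ) (b d : ℤ) →
    Σ ℕ (λ m → (Fin m ↔ AndreITreesWith (suc n) a b d)
    × CommutativeRing._≈_ K (φ K (D^ K n (x₀ K)) a b d) (ι K m))
-- The witness is the number of terms of Dⁿ(x₀) with the prescribed exponents.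
theorem6p5 K _ n a b d = length (contributing K a b d (terms n)) , contributing↔trees K a b d n ,
  subst (λ u → CommutativeRing._≈_ K (φ K u a b d) (ι K (length (contributing K a b d (terms n)))))
        (sym (D^-x₀ K n)) (φ-monomials K a b d (terms n))
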